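{- Let $p$ be an odd prime and let $m,r$ be positive integers with $p\nmid m$ and $r<m$. Then for every integer $s$ with $0\le s\le\langle -\frac{m-r}{m}\rangle_p$, $$\sum_{k=0}^{p-s-1}\frac{(q^r;q^m)_k\,(q^{m-r};q^m)_{k+s}}{(q^m;q^m)_k\,(q^m;q^m)_{k+s}}\equiv(-1)^{\langle -\frac{r}{m}\rangle_p}\,q^{ -\frac{m\langle -\frac{r}{m}\rangle_p(\langle -\frac{r}{m}\rangle_p+1)}{2}}\pmod{[p]}.$$ In particular, if moreover $p\equiv\pm1\pmod m$, then $$\sum_{k=0}^{p-s-1}\frac{(q^r;q^m)_k\,(q^{m-r};q^m)_{k+s}}{(q^m;q^m)_k\,(q^m;q^m)_{k+s}}\equiv(-1)^{\langle -\frac{r}{m}\rangle_p}\,q^{\frac{r(m-r)(1-p^2)}{2m}}\pmod{[p]}.$$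
   Context: For an indeterminate $q$ and an integer $n\ge 0$: $(a;q)_0=1$ and $(a;q)_n=(1-a)(1-aq)\cdots(1-aq^{n-1})$. For a positive integer $p$, $[p]=\frac{1-q^p}{1-q}=1+q+\cdots+q^{p-1}$. For a prime $p$, $[p]$ is irreducible in $\mathbb{Q}[q]$; for rational functions $A,B$ of $q$ whose denominators are coprime to $[p]$, $A\equiv B\pmod{[p]^r}$ means that $A-B$, written in lowest terms, has numerator divisible by $[p]^r$ in $\mathbb{Q}[q]$. For a prime $p$ and a $p$-adic integer $x$ (e.g. a rational number whose denominator is not divisible by $p$), $\langle x\rangle_p$ denotes the least nonnegative residue of $x$ modulo $p$, i.e. the unique integer in $\{0,1,\dots,p-1\}$ congruent to $x$ modulo $p$. -}

module Defs where

open import Algebra.Bundles.Raw using (RawRing)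
import Algebra.Definitions.RawSemiring as RawSemiringDefs
open import Data.Integer as ℤ using (ℤ; +_; -[1+_])
open import Data.List.Base using (List; []; _∷_; map; filter; head; upTo; replicate)
open import Data.Maybe.Base using (fromMaybe)
open import Data.Nat as ℕ using (ℕ; zero; suc; NonZero)
open import Data.Nat.Divisibility using (_∣?_)
open import Data.Rational as ℚ using (ℚ; 0ℚ; 1ℚ; ↥_)
import Data.Rational.Properties as ℚ
open import Data.Sum.Base as Sum using (_⊎_; inj₁; inj₂; [_,_]′)
open import Level using (0ℓ)
open import Relation.Nullary using (¬_; yes; no)
open import Relation.Binary.PropositionalEquality

------------------------------------------------------------------------
-- The polynomial ring ℚ[q]

-- Coefficient lists, constant term first.  Trailing zeros are allowed, so
-- the equality of polynomials is _≈ᵖ_ and not _≡_.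
Poly : Set
Poly = List ℚ

coeff : Poly → ℕ → ℚ
coeff []       i       = 0ℚ
coeff (a ∷ as) zero    = a
coeff (a ∷ as) (suc i) = coeff as i

infix  4 _≈ᵖ_ _≉ᵖ_
infixl 6 _+ᵖ_ _-ᵖ_
infixl 7 _*ᵖ_
infix  8 -ᵖ_

_≈ᵖ_ _≉ᵖ_ : Poly → Poly → Set
f ≈ᵖ g = ∀ i → coeff f i ≡ coeff g i
f ≉ᵖ g = ¬ (f ≈ᵖ g)

0ᵖ 1ᵖ q : Poly
0ᵖ = []
1ᵖ = 1ℚ ∷ []
q  = 0ℚ ∷ 1ℚ ∷ []

_+ᵖ_ : Poly → Poly → Poly
[]       +ᵖ g        = g
(a ∷ as) +ᵖ []       = a ∷ as
(a ∷ as) +ᵖ (b ∷ bs) = (a ℚ.+ b) ∷ (as +ᵖ bs)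

-ᵖ_ : Poly → Poly
-ᵖ_ = map (ℚ.-_)

_-ᵖ_ : Poly → Poly → Poly
f -ᵖ g = f +ᵖ (-ᵖ g)

_*ᵖ_ : Poly → Poly → Poly
[]       *ᵖ g = []
(a ∷ as) *ᵖ g = map (a ℚ.*_) g +ᵖ (0ℚ ∷ (as *ᵖ g))

polyRawRing : RawRing 0ℓ 0ℓ
polyRawRing = record
  { Carrier = Poly
  ; _≈_     = _≈ᵖ_
  ; _+_     = _+ᵖ_
  ; _*_     = _*ᵖ_
  ; -_      = -ᵖ_
  ; 0#      = 0ᵖ
  ; 1#      = 1ᵖ
  }

open RawSemiringDefs (RawRing.rawSemiring polyRawRing) public
  using () renaming (_^_ to _^ᵖ_; _∣_ to _∣ᵖ_; Coprime to Coprimeᵖ)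

------------------------------------------------------------------------
-- ℚ[q] has no zero divisors

coeff-+ : ∀ f g i → coeff (f +ᵖ g) i ≡ coeff f i ℚ.+ coeff g i
coeff-+ []       g        i       = sym (ℚ.+-identityˡ _)
coeff-+ (a ∷ as) []       i       = sym (ℚ.+-identityʳ _)
coeff-+ (a ∷ as) (b ∷ bs) zero    = refl
coeff-+ (a ∷ as) (b ∷ bs) (suc i) = coeff-+ as bs i

coeff-neg : ∀ f i → coeff (-ᵖ f) i ≡ ℚ.- coeff f i
coeff-neg []       i       = refl
coeff-neg (a ∷ as) zero    = refl
coeff-neg (a ∷ as) (suc i) = coeff-neg as i

coeff-scale : ∀ a f i → coeff (map (a ℚ.*_) f) i ≡ a ℚ.* coeff f i
coeff-scale a []       i       = sym (ℚ.*-zeroʳ a)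
coeff-scale a (b ∷ bs) zero    = refl
coeff-scale a (b ∷ bs) (suc i) = coeff-scale a bs i

coeff-* : ∀ a as g i →
          coeff ((a ∷ as) *ᵖ g) i ≡ a ℚ.* coeff g i ℚ.+ coeff (0ℚ ∷ (as *ᵖ g)) i
coeff-* a as g i = trans (coeff-+ (map (a ℚ.*_) g) _ i)
                         (cong (ℚ._+ coeff (0ℚ ∷ (as *ᵖ g)) i) (coeff-scale a g i))

coeff₀-* : ∀ f g → coeff (f *ᵖ g) 0 ≡ coeff f 0 ℚ.* coeff g 0
coeff₀-* []       g = sym (ℚ.*-zeroˡ (coeff g 0))
coeff₀-* (a ∷ as) g = trans (coeff-* a as g 0) (ℚ.+-identityʳ _)

coeff-*-shift : ∀ f g i → coeff (f *ᵖ (0ℚ ∷ g)) (suc i) ≡ coeff (f *ᵖ g) i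
coeff-*-shift []       g i = refl
coeff-*-shift (a ∷ as) g i = begin
  coeff ((a ∷ as) *ᵖ (0ℚ ∷ g)) (suc i)              ≡⟨ coeff-* a as (0ℚ ∷ g) (suc i) ⟩
  a ℚ.* coeff g i ℚ.+ coeff (as *ᵖ (0ℚ ∷ g)) i      ≡⟨ cong (a ℚ.* coeff g i ℚ.+_) (tail i) ⟩
  a ℚ.* coeff g i ℚ.+ coeff (0ℚ ∷ (as *ᵖ g)) i      ≡⟨ coeff-* a as g i ⟨
  coeff ((a ∷ as) *ᵖ g) i                           ∎
  where
  open ≡-Reasoning
  tail : ∀ i → coeff (as *ᵖ (0ℚ ∷ g)) i ≡ coeff (0ℚ ∷ (as *ᵖ g)) i
  tail zero    = trans (coeff₀-* as (0ℚ ∷ g)) (ℚ.*-zeroʳ (coeff as 0))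
  tail (suc i) = coeff-*-shift as g i

ℚ-zero-product : ∀ a b → a ℚ.* b ≡ 0ℚ → a ≡ 0ℚ ⊎ b ≡ 0ℚ
ℚ-zero-product a b ab≡0 with a ℚ.≟ 0ℚ
... | yes a≡0 = inj₁ a≡0
... | no  a≢0 = inj₂ (begin
  b                      ≡⟨ ℚ.*-identityˡ b ⟨
  1ℚ ℚ.* b               ≡⟨ cong (ℚ._* b) (ℚ.*-inverseˡ a) ⟨
  (ℚ.1/ a ℚ.* a) ℚ.* b   ≡⟨ ℚ.*-assoc (ℚ.1/ a) a b ⟩
  ℚ.1/ a ℚ.* (a ℚ.* b)   ≡⟨ cong (ℚ.1/ a ℚ.*_) ab≡0 ⟩
  ℚ.1/ a ℚ.* 0ℚ          ≡⟨ ℚ.*-zeroʳ (ℚ.1/ a) ⟩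
  0ℚ                     ∎)
  where
  open ≡-Reasoning
  instance
    a-nonZero : ℚ.NonZero a
    a-nonZero = ℚ.≢-nonZero a≢0

∷-≈0 : ∀ {a as} → a ≡ 0ℚ → as ≈ᵖ 0ᵖ → a ∷ as ≈ᵖ 0ᵖ
∷-≈0 a≡0 as≈0 zero    = a≡0
∷-≈0 a≡0 as≈0 (suc i) = as≈0 i

tailˡ-*-≈0 : ∀ {a} as g → a ≡ 0ℚ → (a ∷ as) *ᵖ g ≈ᵖ 0ᵖ → as *ᵖ g ≈ᵖ 0ᵖ
tailˡ-*-≈0 as g refl fg≈0 i = begin
  coeff (as *ᵖ g) i                                 ≡⟨ ℚ.+-identityˡ _ ⟨
  0ℚ ℚ.+ coeff (as *ᵖ g) i                          ≡⟨ cong (ℚ._+ coeff (as *ᵖ g) i) (ℚ.*-zeroˡ (coeff g (suc i))) ⟨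
  0ℚ ℚ.* coeff g (suc i) ℚ.+ coeff (as *ᵖ g) i      ≡⟨ coeff-* 0ℚ as g (suc i) ⟨
  coeff ((0ℚ ∷ as) *ᵖ g) (suc i)                    ≡⟨ fg≈0 (suc i) ⟩
  0ℚ                                                ∎
  where open ≡-Reasoning

tailʳ-*-≈0 : ∀ f {b} bs → b ≡ 0ℚ → f *ᵖ (b ∷ bs) ≈ᵖ 0ᵖ → f *ᵖ bs ≈ᵖ 0ᵖ
tailʳ-*-≈0 f bs refl fg≈0 i = trans (sym (coeff-*-shift f bs i)) (fg≈0 (suc i))

*ᵖ-zero-product : ∀ f g → f *ᵖ g ≈ᵖ 0ᵖ → f ≈ᵖ 0ᵖ ⊎ g ≈ᵖ 0ᵖ
*ᵖ-zero-product []       g        fg≈0 = inj₁ λ _ → refl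
*ᵖ-zero-product (a ∷ as) []       fg≈0 = inj₂ λ _ → refl
*ᵖ-zero-product (a ∷ as) (b ∷ bs) fg≈0 =
  [ (λ a≡0 → Sum.map₁ (∷-≈0 a≡0)
      (*ᵖ-zero-product as (b ∷ bs) (tailˡ-*-≈0 as (b ∷ bs) a≡0 fg≈0)))
  , (λ b≡0 → Sum.map₂ (∷-≈0 b≡0)
      (*ᵖ-zero-product (a ∷ as) bs (tailʳ-*-≈0 (a ∷ as) bs b≡0 fg≈0)))
  ]′ (ℚ-zero-product a b (trans (sym (coeff₀-* (a ∷ as) (b ∷ bs))) (fg≈0 0)))

*ᵖ-≉0 : ∀ f g → f ≉ᵖ 0ᵖ → g ≉ᵖ 0ᵖ → f *ᵖ g ≉ᵖ 0ᵖ
*ᵖ-≉0 f g f≉0 g≉0 fg≈0 = [ f≉0 , g≉0 ]′ (*ᵖ-zero-product f g fg≈0)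

1ᵖ≉0 : 1ᵖ ≉ᵖ 0ᵖ
1ᵖ≉0 1≈0 with () ← 1≈0 0

^ᵖ-≉0 : ∀ f n → f ≉ᵖ 0ᵖ → f ^ᵖ n ≉ᵖ 0ᵖ
^ᵖ-≉0 f zero    f≉0 = 1ᵖ≉0
^ᵖ-≉0 f (suc n) f≉0 = *ᵖ-≉0 f (f ^ᵖ n) f≉0 (^ᵖ-≉0 f n f≉0)

q≉0 : q ≉ᵖ 0ᵖ
q≉0 q≈0 with () ← q≈0 1

------------------------------------------------------------------------
-- The field ℚ(q) of rational functions

infix 5 _/_⟨_⟩

-- Fractions, not necessarily in lowest terms; equality is _≃_.
record RatFun : Set where
  constructor _/_⟨_⟩
  field
    num   : Poly
    den   : Poly
    den≉0 : den ≉ᵖ 0ᵖ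

open RatFun public

infix  4 _≃_
infixl 6 _⊕_ _⊖_
infixl 7 _⊗_

_≃_ : RatFun → RatFun → Set
A ≃ B = num A *ᵖ den B ≈ᵖ num B *ᵖ den A

fromPoly : Poly → RatFun
fromPoly f = f / 1ᵖ ⟨ 1ᵖ≉0 ⟩

_⊕_ _⊖_ _⊗_ : RatFun → RatFun → RatFun
A ⊕ B = (num A *ᵖ den B +ᵖ num B *ᵖ den A) / den A *ᵖ den B
          ⟨ *ᵖ-≉0 (den A) (den B) (den≉0 A) (den≉0 B) ⟩
A ⊖ B = (num A *ᵖ den B -ᵖ num B *ᵖ den A) / den A *ᵖ den B
          ⟨ *ᵖ-≉0 (den A) (den B) (den≉0 A) (den≉0 B) ⟩
A ⊗ B = num A *ᵖ num B / den A *ᵖ den B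
          ⟨ *ᵖ-≉0 (den A) (den B) (den≉0 A) (den≉0 B) ⟩

q^_ : ℤ → RatFun
q^ (+ n)    = fromPoly (q ^ᵖ n)
q^ -[1+ n ] = 1ᵖ / q ^ᵖ suc n ⟨ ^ᵖ-≉0 q (suc n) q≉0 ⟩

-- The upper bound is inclusive: f 0 ⊕ f 1 ⊕ ⋯ ⊕ f n.
∑[0…_] : ℕ → (ℕ → RatFun) → RatFun
∑[0… zero  ] f = f 0
∑[0… suc n ] f = ∑[0… n ] f ⊕ f (suc n)

------------------------------------------------------------------------
-- Congruences between rational functions

record _IsLowestTermsOf_ (C A : RatFun) : Set where
  field
    equal   : C ≃ A
    coprime : Coprimeᵖ (num C) (den C)

record DenominatorCoprimeTo (M : Poly) (A : RatFun) : Set where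
  field
    reduced        : RatFun
    isLowestTerms  : reduced IsLowestTermsOf A
    den-coprime    : Coprimeᵖ (den reduced) M

-- The requirement that both denominators be coprime to the modulus is part
-- of the relation, not a hypothesis on its users.
record _≋_[mod_] (A B : RatFun) (M : Poly) : Set where
  field
    denˡ-coprime  : DenominatorCoprimeTo M A
    denʳ-coprime  : DenominatorCoprimeTo M B
    difference    : RatFun
    isLowestTerms : difference IsLowestTermsOf (A ⊖ B)
    num-divisible : M ∣ᵖ num difference

------------------------------------------------------------------------
-- q-analogues

-- 1 + q + ⋯ + qⁿ⁻¹, as its list of coefficients.
[_]q : ℕ → Poly
[ n ]q = replicate n 1ℚ

-- (a ; x)ₙ = (1 - a)(1 - a x) ⋯ (1 - a xⁿ⁻¹)
⦅_⨾_⦆_ : Poly → Poly → ℕ → Poly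
⦅ a ⨾ x ⦆ zero  = 1ᵖ
⦅ a ⨾ x ⦆ suc n = ⦅ a ⨾ x ⦆ n *ᵖ (1ᵖ -ᵖ a *ᵖ x ^ᵖ n)

⦅q^m⨾q^m⦆-≉0 : ∀ m .{{_ : NonZero m}} n → ⦅ q ^ᵖ m ⨾ q ^ᵖ m ⦆ n ≉ᵖ 0ᵖ
⦅q^m⨾q^m⦆-≉0 m         zero    = 1ᵖ≉0
⦅q^m⨾q^m⦆-≉0 m@(suc k) (suc n) =
  *ᵖ-≉0 (⦅ q ^ᵖ m ⨾ q ^ᵖ m ⦆ n) (1ᵖ -ᵖ x *ᵖ x ^ᵖ n) (⦅q^m⨾q^m⦆-≉0 m n) factor≉0
  where
  open ≡-Reasoning
  x : Poly
  x = q ^ᵖ m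
  coeff₀-x : coeff x 0 ≡ 0ℚ
  coeff₀-x = trans (coeff₀-* q (q ^ᵖ k)) (ℚ.*-zeroˡ (coeff (q ^ᵖ k) 0))
  coeff₀-power : coeff (x *ᵖ x ^ᵖ n) 0 ≡ 0ℚ
  coeff₀-power = begin
    coeff (x *ᵖ x ^ᵖ n) 0              ≡⟨ coeff₀-* x (x ^ᵖ n) ⟩
    coeff x 0 ℚ.* coeff (x ^ᵖ n) 0     ≡⟨ cong (ℚ._* coeff (x ^ᵖ n) 0) coeff₀-x ⟩
    0ℚ ℚ.* coeff (x ^ᵖ n) 0            ≡⟨ ℚ.*-zeroˡ (coeff (x ^ᵖ n) 0) ⟩
    0ℚ                                 ∎
  coeff₀-factor : coeff (1ᵖ -ᵖ x *ᵖ x ^ᵖ n) 0 ≡ 1ℚ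
  coeff₀-factor = begin
    coeff (1ᵖ -ᵖ x *ᵖ x ^ᵖ n) 0            ≡⟨ coeff-+ 1ᵖ (-ᵖ (x *ᵖ x ^ᵖ n)) 0 ⟩
    1ℚ ℚ.+ coeff (-ᵖ (x *ᵖ x ^ᵖ n)) 0      ≡⟨ cong (1ℚ ℚ.+_) (coeff-neg (x *ᵖ x ^ᵖ n) 0) ⟩
    1ℚ ℚ.+ ℚ.- coeff (x *ᵖ x ^ᵖ n) 0       ≡⟨ cong (λ c → 1ℚ ℚ.+ ℚ.- c) coeff₀-power ⟩
    1ℚ                                     ∎
  factor≉0 : 1ᵖ -ᵖ x *ᵖ x ^ᵖ n ≉ᵖ 0ᵖ
  factor≉0 h with () ← trans (sym coeff₀-factor) (h 0)

summand : (m r s : ℕ) .{{_ : NonZero m}} → ℕ → RatFun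
summand m r s k =
  ⦅ q ^ᵖ r ⨾ q ^ᵖ m ⦆ k *ᵖ ⦅ q ^ᵖ (m ℕ.∸ r) ⨾ q ^ᵖ m ⦆ (k ℕ.+ s)
  / ⦅ q ^ᵖ m ⨾ q ^ᵖ m ⦆ k *ᵖ ⦅ q ^ᵖ m ⨾ q ^ᵖ m ⦆ (k ℕ.+ s)
  ⟨ *ᵖ-≉0 (⦅ q ^ᵖ m ⨾ q ^ᵖ m ⦆ k) (⦅ q ^ᵖ m ⨾ q ^ᵖ m ⦆ (k ℕ.+ s))
      (⦅q^m⨾q^m⦆-≉0 m k) (⦅q^m⨾q^m⦆-≉0 m (k ℕ.+ s)) ⟩

[-1]^_ : ℕ → RatFun
[-1]^ n = fromPoly ((-ᵖ 1ᵖ) ^ᵖ n)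

------------------------------------------------------------------------
-- Residues of p-adic integers

-- ⟨ x ⟩[ p ] is the a in {0, …, p - 1} with x ≡ a (mod p), where x ≡ a means
-- that p divides the numerator of x - a (ℚ is stored in lowest terms).  The
-- default 0 is used only if p and the denominator of x are not coprime, in
-- which case no such a exists.
⟨_⟩[_] : ℚ → ℕ → ℕ
⟨ x ⟩[ p ] =
  fromMaybe 0 (head (filter (λ a → p ∣? ℤ.∣ ↥ (x ℚ.- (+ a) ℚ./ 1) ∣) (upTo p)))

{-# OPTIONS --safe #-}

-- Write a = ⟨-r/m⟩ and b = ⟨-(m-r)/m⟩, so that a + b = p - 1.  In K = ℚ[q]/([p]) put Q = qᵐ, α = qʳ = Qᵇ⁺¹
-- and β = qᵐ⁻ʳ = Qᵃ⁺¹; then αβ = Q and the sum is T(s) = ∑ u(k) v(k + s) with u(k) = (α;Q)ₖ/(Q;Q)ₖ and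
-- v(k) = (β;Q)ₖ/(Q;Q)ₖ.  For k < p, u(k) vanishes unless k ≤ a, and v(k) vanishes unless k ≤ b.  For s < b the
-- sum T(s + 1) - T(s) telescopes to 0, and T(b) has the single term v(b), which is (-1)ᵇ Q^(-b(b+1)/2) because
-- the factors of (β;Q)_b are, up to powers of -Q, those of (Q;Q)_b in reverse order.
--
-- The denominators are units of K: modulo [p], 1 - q divides p, and 1 - qⁿ divides 1 - qⁿⁿ′ = 1 - q for
-- nn′ ≡ 1 (mod p).
module Submission where

open import Defs

open import Algebra.Bundles using (CommutativeRing; CommutativeSemiring)
import Algebra.Definitions.RawSemiring as RawSemiringDefs
import Algebra.Properties.AbelianGroup as AbelianGroupProperties
import Algebra.Properties.CommutativeSemigroup.Divisibility as Divisibility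
import Algebra.Properties.Ring as RingProperties
import Algebra.Properties.Semiring.Exp as Exp
import Algebra.Properties.Semiring.Mult as Mult
import Algebra.Properties.Semiring.Mult.TCOptimised as Mult′
import Algebra.Solver.Ring as RingSolver
open import Algebra.Solver.Ring.AlmostCommutativeRing using (fromCommutativeRing; _-Raw-AlmostCommutative⟶_)
open import Data.Empty using (⊥-elim)
open import Data.Integer as ℤ using (ℤ; +_; -[1+_]; 1ℤ)
open import Data.Integer.DivMod using (_%ℕ_; _/ℕ_; n%ℕd<d; a≡a%ℕn+[a/ℕn]*n)
import Data.Integer.Divisibility.Signed as ℤ
import Data.Integer.Properties as ℤ
open import Data.List.Base using (List; []; _∷_; map; length; head; filter; upTo)
open import Data.List.Membership.Propositional using (_∈_)
open import Data.List.Membership.Propositional.Properties using (∈-filter⁺; ∈-filter⁻; ∈-upTo⁺; ∈-upTo⁻)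
open import Data.List.Relation.Unary.Any using (here)
open import Data.Maybe.Base using (Maybe; just; nothing; fromMaybe)
open import Data.Nat as ℕ using (ℕ; zero; suc; _≤_; _<_; z≤n; s≤s; NonZero)
import Data.Nat.Coprimality as ℕ
open import Data.Nat.Divisibility using (_∤_; _∣?_; divides)
import Data.Nat.Divisibility as ℕ
open import Data.Nat.DivMod using (m*n/n≡m)
open import Data.Nat.GCD using (module Bézout)
open import Data.Nat.Primality using (Prime; euclidsLemma; prime⇒irreducible; prime⇒nonZero; prime⇒nonTrivial)
import Data.Nat.Properties as ℕ
open import Data.Product using (_×_; ∃-syntax; _,_; proj₁; proj₂)
open import Data.Rational as ℚ using (ℚ; mkℚ; 0ℚ; 1ℚ; ↥_; ↧_; ↧ₙ_)
import Data.Rational.Properties as ℚ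
open import Data.Rational.Unnormalised as ℚᵘ using (mkℚᵘ)
import Data.Rational.Unnormalised.Properties as ℚᵘ
open import Data.Sum.Base using (_⊎_; inj₁; inj₂; [_,_]′)
open import Level using (0ℓ; _⊔_)
import Relation.Binary.Reasoning.Setoid as SetoidReasoning
open import Relation.Binary.PropositionalEquality as ≡ using (_≡_)
open import Relation.Nullary using (¬_; yes; no)
open import Relation.Unary using (Decidable)

-- Commutative rings and their quotients

-- The telescoping rests on αβ = Q: it turns αβQˢ⁺ᴺ into Qˢ⁺ᴺ⁺¹, the power in the denominator of v(N
-- + s + 1) / v(N + s), and the factors left over are those of u(N + 1) / u(N). The boundary term
-- contains u(N) with N > a and is zero, but the telescoped identity yields the difference only
-- after division by 1 - βQˢ = 1 - Qᵃ⁺¹⁺ˢ. This is a unit while s < b and is zero at s = b, where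
-- the induction ends.
--
-- The sum comes out in terms of b, whereas the theorem speaks of a. Since qᵖ = 1 in K, exponents of
-- q count only modulo p, and b(b + 1) - a(a + 1) = (b - a)p; the signs agree because a + b = p - 1
-- is even.
--
-- The congruence is about lowest terms, which cannot be followed through a sum. Each fraction is
-- therefore given a residue class in K, compatible with sums and products, and lowest terms are
-- produced only at the end, from Bézout identities in ℚ[q].

module IntegerCoefficients {c ℓ} (R : CommutativeRing c ℓ) where
  open CommutativeRing R
  open RingProperties ring using (-‿distribˡ-*; -‿distribʳ-*; -0#≈0#; -‿involutive)
  open AbelianGroupProperties +-abelianGroup using (⁻¹-∙-comm)
  open Mult′ semiring using (1+×; ×-homo-+; ×1-homo-*) renaming (_×_ to _·_)
  open SetoidReasoning setoid

  -- Integers serve as solver coefficients because their equality is decidable in every ring. With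
  -- the optimised multiple, `1 · 1#` reduces to `1#`, so `con ℤ.1ℤ` in a solver equation denotes
  -- `1#` definitionally.
  fromℤ : ℤ → Carrier
  fromℤ (+ n)    = n · 1#
  fromℤ -[1+ n ] = - (suc n · 1#)

  fromℤ-neg : ∀ i → fromℤ (ℤ.- i) ≈ - fromℤ i
  fromℤ-neg (+ zero)  = sym -0#≈0#
  fromℤ-neg (+ suc n) = refl
  fromℤ-neg -[1+ n ]  = sym (-‿involutive _)

  fromℤ-⊖ : ∀ m n → fromℤ (m ℤ.⊖ n) ≈ m · 1# - n · 1#
  fromℤ-⊖ m       zero    = sym (trans (+-congˡ -0#≈0#) (+-identityʳ _))
  fromℤ-⊖ zero    (suc n) = sym (+-identityˡ _)
  fromℤ-⊖ (suc m) (suc n) = begin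
    fromℤ (suc m ℤ.⊖ suc n)                ≡⟨ ≡.cong fromℤ (ℤ.[1+m]⊖[1+n]≡m⊖n m n) ⟩
    fromℤ (m ℤ.⊖ n)                        ≈⟨ fromℤ-⊖ m n ⟩
    m · 1# - n · 1#                        ≈⟨ +-congʳ (+-identityˡ _) ⟨
    0# + m · 1# - n · 1#                   ≈⟨ +-congʳ (+-congʳ (-‿inverseʳ 1#)) ⟨
    1# - 1# + m · 1# - n · 1#              ≈⟨ +-congʳ (trans (+-assoc _ _ _) (+-congˡ (+-comm _ _))) ⟩
    1# + (m · 1# - 1#) - n · 1#            ≈⟨ +-congʳ (+-assoc _ _ _) ⟨
    1# + m · 1# - 1# - n · 1#              ≈⟨ +-assoc _ _ _ ⟩
    1# + m · 1# + (- 1# - n · 1#)          ≈⟨ +-cong (sym (1+× m 1#)) (trans (⁻¹-∙-comm _ _) (-‿cong (sym (1+× n 1#)))) ⟩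
    suc m · 1# - suc n · 1#                ∎

  fromℤ-+ : ∀ i j → fromℤ (i ℤ.+ j) ≈ fromℤ i + fromℤ j
  fromℤ-+ (+ m)    (+ n)    = ×-homo-+ 1# m n
  fromℤ-+ (+ m)    -[1+ n ] = fromℤ-⊖ m (suc n)
  fromℤ-+ -[1+ m ] (+ n)    = trans (fromℤ-⊖ n (suc m)) (+-comm _ _)
  fromℤ-+ -[1+ m ] -[1+ n ] = begin
    - (suc (suc (m ℕ.+ n)) · 1#)           ≡⟨ ≡.cong (λ k → - (suc k · 1#)) (ℕ.+-suc m n) ⟨
    - ((suc m ℕ.+ suc n) · 1#)             ≈⟨ -‿cong (×-homo-+ 1# (suc m) (suc n)) ⟩
    - (suc m · 1# + suc n · 1#)            ≈⟨ ⁻¹-∙-comm _ _ ⟨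
    - (suc m · 1#) - suc n · 1#            ∎

  fromℤ-*-pos : ∀ m j → fromℤ (+ m ℤ.* j) ≈ fromℤ (+ m) * fromℤ j
  fromℤ-*-pos m (+ n) = begin
    fromℤ (+ m ℤ.* + n)                    ≡⟨ ≡.cong fromℤ (ℤ.pos-* m n) ⟨
    (m ℕ.* n) · 1#                         ≈⟨ ×1-homo-* m n ⟩
    (m · 1#) * (n · 1#)                    ∎
  fromℤ-*-pos m -[1+ n ] = begin
    fromℤ (+ m ℤ.* (ℤ.- (+ suc n)))        ≡⟨ ≡.cong fromℤ (ℤ.neg-distribʳ-* (+ m) (+ suc n)) ⟨
    fromℤ (ℤ.- (+ m ℤ.* + suc n))          ≈⟨ fromℤ-neg (+ m ℤ.* + suc n) ⟩
    - fromℤ (+ m ℤ.* + suc n)              ≈⟨ -‿cong (fromℤ-*-pos m (+ suc n)) ⟩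
    - ((m · 1#) * (suc n · 1#))            ≈⟨ -‿distribʳ-* _ _ ⟩
    (m · 1#) * (- (suc n · 1#))            ∎

  fromℤ-* : ∀ i j → fromℤ (i ℤ.* j) ≈ fromℤ i * fromℤ j
  fromℤ-* (+ m)    j = fromℤ-*-pos m j
  fromℤ-* -[1+ m ] j = begin
    fromℤ (ℤ.- (+ suc m) ℤ.* j)            ≡⟨ ≡.cong fromℤ (ℤ.neg-distribˡ-* (+ suc m) j) ⟨
    fromℤ (ℤ.- (+ suc m ℤ.* j))            ≈⟨ fromℤ-neg (+ suc m ℤ.* j) ⟩
    - fromℤ (+ suc m ℤ.* j)                ≈⟨ -‿cong (fromℤ-*-pos (suc m) j) ⟩
    - ((suc m · 1#) * fromℤ j)             ≈⟨ -‿distribˡ-* _ _ ⟩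
    - (suc m · 1#) * fromℤ j               ∎

  fromℤ-morphism : ℤ.+-*-rawRing -Raw-AlmostCommutative⟶ fromCommutativeRing R
  fromℤ-morphism = record
    { ⟦_⟧    = fromℤ
    ; +-homo = fromℤ-+
    ; *-homo = fromℤ-*
    ; -‿homo = fromℤ-neg
    ; 0-homo = refl
    ; 1-homo = refl
    }

  fromℤ-≟ : ∀ i j → Maybe (fromℤ i ≈ fromℤ j)
  fromℤ-≟ i j with i ℤ.≟ j
  ... | yes i≡j = just (reflexive (≡.cong fromℤ i≡j))
  ... | no  _   = nothing

  open RingSolver ℤ.+-*-rawRing (fromCommutativeRing R) fromℤ-morphism fromℤ-≟ public
    using (solve; con; _:+_; _:*_; _:-_; :-_; _:=_)

module Quotient {c ℓ} (R : CommutativeRing c ℓ) (M : CommutativeRing.Carrier R) where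
  open CommutativeRing R
  open Divisibility *-commutativeSemigroup using (_∣_; _,_)
  open IntegerCoefficients R
  open SetoidReasoning setoid

  infix 4 _~_
  -- The quotient keeps the carrier and the operations and only coarsens equality, so an element is
  -- its own residue class and no projection map appears.
  _~_ : Carrier → Carrier → Set _
  x ~ y = M ∣ x - y

  ≈⇒~ : ∀ {x y} → x ≈ y → x ~ y
  ≈⇒~ {x} {y} x≈y = 0# , (begin
    0# * M   ≈⟨ zeroˡ M ⟩
    0#       ≈⟨ -‿inverseʳ y ⟨
    y - y    ≈⟨ +-congʳ x≈y ⟨
    x - y    ∎)

  ~-sym : ∀ {x y} → x ~ y → y ~ x
  ~-sym {x} {y} (k , kM≈x-y) = - k , (begin
    - k * M      ≈⟨ solve 2 (λ k M → :- k :* M := :- (k :* M)) refl k M ⟩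
    - (k * M)    ≈⟨ -‿cong kM≈x-y ⟩
    - (x - y)    ≈⟨ solve 2 (λ x y → :- (x :- y) := y :- x) refl x y ⟩
    y - x        ∎)

  ~-trans : ∀ {x y z} → x ~ y → y ~ z → x ~ z
  ~-trans {x} {y} {z} (k , kM≈x-y) (l , lM≈y-z) = k + l , (begin
    (k + l) * M        ≈⟨ distribʳ M k l ⟩
    k * M + l * M      ≈⟨ +-cong kM≈x-y lM≈y-z ⟩
    x - y + (y - z)    ≈⟨ solve 3 (λ x y z → x :- y :+ (y :- z) := x :- z) refl x y z ⟩
    x - z              ∎)

  ~-+-cong : ∀ {x y u v} → x ~ y → u ~ v → x + u ~ y + v
  ~-+-cong {x} {y} {u} {v} (k , kM≈x-y) (l , lM≈u-v) = k + l , (begin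
    (k + l) * M        ≈⟨ distribʳ M k l ⟩
    k * M + l * M      ≈⟨ +-cong kM≈x-y lM≈u-v ⟩
    x - y + (u - v)    ≈⟨ solve 4 (λ x y u v → x :- y :+ (u :- v) := x :+ u :- (y :+ v)) refl x y u v ⟩
    x + u - (y + v)    ∎)

  ~-neg-cong : ∀ {x y} → x ~ y → - x ~ - y
  ~-neg-cong {x} {y} (k , kM≈x-y) = - k , (begin
    - k * M      ≈⟨ solve 2 (λ k M → :- k :* M := :- (k :* M)) refl k M ⟩
    - (k * M)    ≈⟨ -‿cong kM≈x-y ⟩
    - (x - y)    ≈⟨ solve 2 (λ x y → :- (x :- y) := :- x :- :- y) refl x y ⟩
    - x - - y    ∎)

  ~-*-cong : ∀ {x y u v} → x ~ y → u ~ v → x * u ~ y * v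
  ~-*-cong {x} {y} {u} {v} (k , kM≈x-y) (l , lM≈u-v) = k * u + y * l , (begin
    (k * u + y * l) * M              ≈⟨ solve 5 (λ k u y l M → (k :* u :+ y :* l) :* M := k :* M :* u :+ y :* (l :* M)) refl k u y l M ⟩
    k * M * u + y * (l * M)          ≈⟨ +-cong (*-congʳ kM≈x-y) (*-congˡ lM≈u-v) ⟩
    (x - y) * u + y * (u - v)        ≈⟨ solve 4 (λ x y u v → (x :- y) :* u :+ y :* (u :- v) := x :* u :- y :* v) refl x y u v ⟩
    x * u - y * v                    ∎)

  ~0⇒∣ : ∀ {x} → x ~ 0# → M ∣ x
  ~0⇒∣ {x} (k , kM≈x-0) = k , trans kM≈x-0 (solve 1 (λ x → x :- con ℤ.0ℤ := x) refl x)

  M~0 : M ~ 0#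
  M~0 = 1# , solve 1 (λ M → con ℤ.1ℤ :* M := M :- con ℤ.0ℤ) refl M

  quotientRing : CommutativeRing c _
  quotientRing = record
    { Carrier = Carrier
    ; _≈_ = _~_
    ; _+_ = _+_
    ; _*_ = _*_
    ; -_  = -_
    ; 0#  = 0#
    ; 1#  = 1#
    ; isCommutativeRing = record
      { isRing = record
        { +-isAbelianGroup = record
          { isGroup = record
            { isMonoid = record
              { isSemigroup = record
                { isMagma = record
                  { isEquivalence = record { refl = ≈⇒~ refl ; sym = ~-sym ; trans = ~-trans }
                  ; ∙-cong = ~-+-cong
                  }
                ; assoc = λ x y z → ≈⇒~ (+-assoc x y z)
                }
              ; identity = (λ x → ≈⇒~ (+-identityˡ x)) , (λ x → ≈⇒~ (+-identityʳ x))
              }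
            ; inverse = (λ x → ≈⇒~ (-‿inverseˡ x)) , (λ x → ≈⇒~ (-‿inverseʳ x))
            ; ⁻¹-cong = ~-neg-cong
            }
          ; comm = λ x y → ≈⇒~ (+-comm x y)
          }
        ; *-cong = ~-*-cong
        ; *-assoc = λ x y z → ≈⇒~ (*-assoc x y z)
        ; *-identity = (λ x → ≈⇒~ (*-identityˡ x)) , (λ x → ≈⇒~ (*-identityʳ x))
        ; distrib = (λ x y z → ≈⇒~ (distribˡ x y z)) , (λ x y z → ≈⇒~ (distribʳ x y z))
        }
      ; *-comm = λ x y → ≈⇒~ (*-comm x y)
      }
    }

-- q-series in a commutative ring

triangular : ℕ → ℕ
triangular zero    = 0
triangular (suc n) = suc n ℕ.+ triangular n

module QSeries {c ℓ} (R : CommutativeRing c ℓ) where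
  open CommutativeRing R
  open Divisibility *-commutativeSemigroup using (_∣_; _,_; module _∣ʳ_; ∣-respˡ-≈)
  open Exp semiring using (_^_; ^-homo-*)
  open IntegerCoefficients R
  open SetoidReasoning setoid

  ∑< : ℕ → (ℕ → Carrier) → Carrier
  ∑< zero    f = 0#
  ∑< (suc n) f = ∑< n f + f n

  ∑<-head : ∀ n {f} → (∀ k → 0 < k → k ≤ n → f k ≈ 0#) → ∑< (suc n) f ≈ f 0
  ∑<-head zero    f≈0 = +-identityˡ _
  ∑<-head (suc n) {f} f≈0 = begin
    ∑< (suc n) f + f (suc n)   ≈⟨ +-cong (∑<-head n λ k 0<k k≤n → f≈0 k 0<k (ℕ.m≤n⇒m≤1+n k≤n)) (f≈0 (suc n) (s≤s z≤n) ℕ.≤-refl) ⟩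
    f 0 + 0#                   ≈⟨ +-identityʳ _ ⟩
    f 0                        ∎

  unit-cancelʳ : ∀ {x y z} → x ∣ 1# → y * x ≈ z * x → y ≈ z
  unit-cancelʳ {x} {y} {z} (w , wx≈1) yx≈zx = begin
    y              ≈⟨ *-identityʳ y ⟨
    y * 1#         ≈⟨ *-congˡ wx≈1 ⟨
    y * (w * x)    ≈⟨ rearrange y w x ⟩
    y * x * w      ≈⟨ *-congʳ yx≈zx ⟩
    z * x * w      ≈⟨ rearrange z w x ⟨
    z * (w * x)    ≈⟨ *-congˡ wx≈1 ⟩
    z * 1#         ≈⟨ *-identityʳ z ⟩
    z              ∎
    where
    rearrange : ∀ y w x → y * (w * x) ≈ y * x * w
    rearrange = solve 3 (λ y w x → y :* (w :* x) := y :* x :* w) refl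

  unit-* : ∀ {x y} → x ∣ 1# → y ∣ 1# → x * y ∣ 1#
  unit-* {x} {y} (w , wx≈1) (z , zy≈1) = w * z , (begin
    w * z * (x * y)      ≈⟨ solve 4 (λ w z x y → w :* z :* (x :* y) := w :* x :* (z :* y)) refl w z x y ⟩
    w * x * (z * y)      ≈⟨ *-cong wx≈1 zy≈1 ⟩
    1# * 1#              ≈⟨ *-identityʳ 1# ⟩
    1#                   ∎)

  pochhammer : Carrier → Carrier → ℕ → Carrier
  pochhammer a x zero    = 1#
  pochhammer a x (suc n) = pochhammer a x n * (1# - a * x ^ n)

  -- The defining recursion splits off the last factor; reversing the order of the factors also
  -- requires splitting off the first.
  pochhammer-peel : ∀ a x n → pochhammer a x (suc n) ≈ (1# - a) * pochhammer (a * x) x n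
  pochhammer-peel a x zero    = solve 1 (λ a → con ℤ.1ℤ :* (con ℤ.1ℤ :- a :* con ℤ.1ℤ) := (con ℤ.1ℤ :- a) :* con ℤ.1ℤ) refl a
  pochhammer-peel a x (suc n) = begin
    pochhammer a x (suc n) * (1# - a * (x * x ^ n))
      ≈⟨ *-congʳ (pochhammer-peel a x n) ⟩
    (1# - a) * pochhammer (a * x) x n * (1# - a * (x * x ^ n))
      ≈⟨ solve 4 (λ a x y P → (con ℤ.1ℤ :- a) :* P :* (con ℤ.1ℤ :- a :* (x :* y)) := (con ℤ.1ℤ :- a) :* (P :* (con ℤ.1ℤ :- a :* x :* y))) refl a x (x ^ n) (pochhammer (a * x) x n) ⟩
    (1# - a) * (pochhammer (a * x) x n * (1# - a * x * x ^ n)) ∎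

  -- The factor of index `n` is zero and occurs in every longer product.
  pochhammer-vanish : ∀ {a x} n k → a * x ^ n ≈ 1# → n < k → pochhammer a x k ≈ 0#
  pochhammer-vanish {a} {x} n (suc k) axⁿ≈1 (s≤s n≤k) with ℕ.m≤n⇒m<n∨m≡n n≤k
  ... | inj₁ n<k    = trans (*-congʳ (pochhammer-vanish n k axⁿ≈1 n<k)) (zeroˡ _)
  ... | inj₂ ≡.refl = begin
    pochhammer a x n * (1# - a * x ^ n)    ≈⟨ *-congˡ (+-congˡ (-‿cong axⁿ≈1)) ⟩
    pochhammer a x n * (1# - 1#)           ≈⟨ *-congˡ (-‿inverseʳ 1#) ⟩
    pochhammer a x n * 0#                  ≈⟨ zeroʳ _ ⟩
    0#                                     ∎

  -- With a = x⁻ᵇ the factors 1 - x⁻ʲ = -x⁻ʲ (1 - xʲ) are those of (x ; x)_b in reverse order.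
  pochhammer-reverse : ∀ {a x} b → a * x ^ b ≈ 1# →
    pochhammer a x b * x ^ triangular b ≈ (- 1#) ^ b * pochhammer x x b
  pochhammer-reverse         zero    _      = refl
  pochhammer-reverse {a} {x} (suc b) axᵇ⁺¹≈1 = begin
    pochhammer a x (suc b) * x ^ (suc b ℕ.+ triangular b)
      ≈⟨ *-cong (pochhammer-peel a x b) (^-homo-* x (suc b) (triangular b)) ⟩
    (1# - a) * pochhammer (a * x) x b * (y * x ^ triangular b)
      ≈⟨ solve 4 (λ a P y T → (con ℤ.1ℤ :- a) :* P :* (y :* T) := (y :- a :* y) :* (P :* T)) refl a (pochhammer (a * x) x b) y (x ^ triangular b) ⟩
    (y - a * y) * (pochhammer (a * x) x b * x ^ triangular b)
      ≈⟨ *-cong (+-congˡ (-‿cong axᵇ⁺¹≈1)) (pochhammer-reverse b (trans (*-assoc a x (x ^ b)) axᵇ⁺¹≈1)) ⟩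
    (y - 1#) * ((- 1#) ^ b * pochhammer x x b)
      ≈⟨ solve 3 (λ y s P → (y :- con ℤ.1ℤ) :* (s :* P) := :- con ℤ.1ℤ :* s :* (P :* (con ℤ.1ℤ :- y))) refl y ((- 1#) ^ b) (pochhammer x x b) ⟩
    - 1# * (- 1#) ^ b * (pochhammer x x b * (1# - y)) ∎
    where y = x ^ suc b

  -- Truncated hypergeometric sums at a root of unity

  module RootOfUnity
    (Q : Carrier) (p : ℕ) (1-Qʲ-unit : ∀ j → 0 < j → j < p → 1# - Q ^ j ∣ 1#)
    where

    pochhammer-unit : ∀ k → k < p → pochhammer Q Q k ∣ 1#
    pochhammer-unit zero    k<p   = 1# , *-identityʳ 1#
    pochhammer-unit (suc k) 1+k<p =
      unit-* (pochhammer-unit k (ℕ.<-trans (ℕ.n<1+n k) 1+k<p)) (1-Qʲ-unit (suc k) (s≤s z≤n) 1+k<p)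

    -- Free of division, and restricted to `k < p` because only there is the denominator
    -- `pochhammer Q Q k` known to be a unit.
    _IsRatioFor_ : (ℕ → Carrier) → Carrier → Set _
    u IsRatioFor α = ∀ k → k < p → u k * pochhammer Q Q k ≈ pochhammer α Q k

    ratio-zero : ∀ {u α} → u IsRatioFor α → 0 < p → u 0 ≈ 1#
    ratio-zero ratio 0<p = trans (sym (*-identityʳ _)) (ratio 0 0<p)

    -- The term ratio of a hypergeometric sequence, cleared of denominators. Together with `αβ≈Q` it
    -- is all that the telescoping uses about `u` and `v`.
    ratio-suc : ∀ {u α} → u IsRatioFor α → ∀ k → suc k < p →
                u (suc k) * (1# - Q ^ suc k) ≈ u k * (1# - α * Q ^ k)
    ratio-suc {u} {α} ratio k 1+k<p = unit-cancelʳ (pochhammer-unit k k<p) (begin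
      u (suc k) * (1# - Q ^ suc k) * pochhammer Q Q k      ≈⟨ swap _ _ _ ⟩
      u (suc k) * (pochhammer Q Q k * (1# - Q ^ suc k))    ≈⟨ ratio (suc k) 1+k<p ⟩
      pochhammer α Q k * (1# - α * Q ^ k)                  ≈⟨ *-congʳ (ratio k k<p) ⟨
      u k * pochhammer Q Q k * (1# - α * Q ^ k)            ≈⟨ trans (*-assoc _ _ _) (sym (swap _ _ _)) ⟩
      u k * (1# - α * Q ^ k) * pochhammer Q Q k            ∎)
      where
      k<p : k < p
      k<p = ℕ.<-trans (ℕ.n<1+n k) 1+k<p
      swap : ∀ x y z → x * y * z ≈ x * (z * y)
      swap = solve 3 (λ x y z → x :* y :* z := x :* (z :* y)) refl

    ratio-vanish : ∀ {u α} → u IsRatioFor α → ∀ a → α * Q ^ a ≈ 1# →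
                   ∀ k → a < k → k < p → u k ≈ 0#
    ratio-vanish {u} {α} ratio a αQᵃ≈1 k a<k k<p = unit-cancelʳ (pochhammer-unit k k<p) (begin
      u k * pochhammer Q Q k     ≈⟨ ratio k k<p ⟩
      pochhammer α Q k           ≈⟨ pochhammer-vanish a k αQᵃ≈1 a<k ⟩
      0#                         ≈⟨ zeroˡ _ ⟨
      0# * pochhammer Q Q k      ∎)

    -- The value from `p` on is an arbitrary default: `_IsRatioFor_` constrains only the indices
    -- below `p`.
    ratio : Carrier → ℕ → Carrier
    ratio α k with k ℕ.<? p
    ... | yes k<p = pochhammer α Q k * _∣ʳ_.quotient (pochhammer-unit k k<p)
    ... | no  _   = 0#

    ratio-isRatio : ∀ α → ratio α IsRatioFor α
    ratio-isRatio α k k<p with k ℕ.<? p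
    ... | no  k≮p  = ⊥-elim (k≮p k<p)
    ... | yes k<p′ with w , w[Q]≈1 ← pochhammer-unit k k<p′ = begin
      pochhammer α Q k * w * pochhammer Q Q k        ≈⟨ *-assoc _ _ _ ⟩
      pochhammer α Q k * (w * pochhammer Q Q k)      ≈⟨ *-congˡ w[Q]≈1 ⟩
      pochhammer α Q k * 1#                          ≈⟨ *-identityʳ _ ⟩
      pochhammer α Q k                               ∎

    module Convolution {u v α β} (u-ratio : u IsRatioFor α) (v-ratio : v IsRatioFor β)
                       (αβ≈Q : α * β ≈ Q) where

      -- The summand is the q-hypergeometric term of a ₂φ₁ with argument Q whose
      -- parameters satisfy c = abQ, so it is Gosper-summable.
      telescope : ∀ s N → N ℕ.+ s < p →
        (1# - β * Q ^ s) * ∑< N (λ k → u k * (v (suc (k ℕ.+ s)) - v (k ℕ.+ s)))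
        ≈ - (β * Q ^ s) * (1# - Q ^ N) * (u N * v (N ℕ.+ s))
      telescope s zero _ =
        solve 2 (λ y w → (con ℤ.1ℤ :- y) :* con ℤ.0ℤ := :- y :* (con ℤ.1ℤ :- con ℤ.1ℤ) :* w) refl (β * Q ^ s) (u 0 * v s)
      telescope s (suc N) 1+N+s<p = begin
        (1# - y) * (∑< N f + f N)
          ≈⟨ distribˡ _ _ _ ⟩
        (1# - y) * ∑< N f + (1# - y) * f N
          ≈⟨ +-congʳ (telescope s N (ℕ.<-trans (ℕ.n<1+n _) 1+N+s<p)) ⟩
        - y * (1# - z) * (u N * v₀) + (1# - y) * (u N * (v₁ - v₀))
          ≈⟨ solve 5 (λ y z u v₀ v₁ →
               :- y :* (con ℤ.1ℤ :- z) :* (u :* v₀) :+ (con ℤ.1ℤ :- y) :* (u :* (v₁ :- v₀))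
               := u :* ((con ℤ.1ℤ :- y) :* v₁ :- v₀ :* (con ℤ.1ℤ :- y :* z))) refl y z (u N) v₀ v₁ ⟩
        u N * ((1# - y) * v₁ - v₀ * (1# - y * z))
          ≈⟨ *-congˡ (+-congˡ (-‿cong v-step)) ⟨
        u N * ((1# - y) * v₁ - v₁ * (1# - α * y * z))
          ≈⟨ solve 5 (λ α y z u v₁ →
               u :* ((con ℤ.1ℤ :- y) :* v₁ :- v₁ :* (con ℤ.1ℤ :- α :* y :* z))
               := :- y :* (u :* (con ℤ.1ℤ :- α :* z)) :* v₁) refl α y z (u N) v₁ ⟩
        - y * (u N * (1# - α * z)) * v₁
          ≈⟨ *-congʳ (*-congˡ (ratio-suc u-ratio N (ℕ.≤-<-trans (ℕ.m≤m+n (suc N) s) 1+N+s<p))) ⟨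
        - y * (u (suc N) * (1# - Q ^ suc N)) * v₁
          ≈⟨ solve 4 (λ y u w v₁ → :- y :* (u :* w) :* v₁ := :- y :* w :* (u :* v₁)) refl y (u (suc N)) (1# - Q ^ suc N) v₁ ⟩
        - y * (1# - Q ^ suc N) * (u (suc N) * v₁) ∎
        where
        y = β * Q ^ s
        z = Q ^ N
        v₀ = v (N ℕ.+ s)
        v₁ = v (suc (N ℕ.+ s))
        f : ℕ → Carrier
        f k = u k * (v (suc (k ℕ.+ s)) - v (k ℕ.+ s))
        Q-step : α * y * z ≈ Q ^ suc (N ℕ.+ s)
        Q-step = begin
          α * (β * Q ^ s) * Q ^ N    ≈⟨ solve 4 (λ α β x z → α :* (β :* x) :* z := α :* β :* (z :* x)) refl α β (Q ^ s) z ⟩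
          α * β * (Q ^ N * Q ^ s)    ≈⟨ *-cong αβ≈Q (sym (^-homo-* Q N s)) ⟩
          Q * Q ^ (N ℕ.+ s)          ∎
        βQ-step : β * Q ^ (N ℕ.+ s) ≈ y * z
        βQ-step = begin
          β * Q ^ (N ℕ.+ s)      ≈⟨ *-congˡ (^-homo-* Q N s) ⟩
          β * (Q ^ N * Q ^ s)    ≈⟨ solve 3 (λ β x z → β :* (z :* x) := β :* x :* z) refl β (Q ^ s) z ⟩
          β * Q ^ s * Q ^ N      ∎
        v-step : v₁ * (1# - α * y * z) ≈ v₀ * (1# - y * z)
        v-step = begin
          v₁ * (1# - α * y * z)                ≈⟨ *-congˡ (+-congˡ (-‿cong Q-step)) ⟩
          v₁ * (1# - Q ^ suc (N ℕ.+ s))        ≈⟨ ratio-suc v-ratio (N ℕ.+ s) 1+N+s<p ⟩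
          v₀ * (1# - β * Q ^ (N ℕ.+ s))        ≈⟨ *-congˡ (+-congˡ (-‿cong βQ-step)) ⟩
          v₀ * (1# - y * z)                    ∎

      module _ {a b} (1+a+b≡p : suc (a ℕ.+ b) ≡ p)
               (αQᵃ≈1 : α * Q ^ a ≈ 1#) (β≈Qᵃ⁺¹ : β ≈ Q ^ suc a) (βQᵇ≈1 : β * Q ^ b ≈ 1#) where

        b<p : b < p
        b<p = ≡.subst (b <_) 1+a+b≡p (s≤s (ℕ.m≤n+m b a))

        -- Raising the shift by one shortens the sum by one term, which keeps the number of terms
        -- plus the shift equal to `p`. The term that drops out and the boundary term of `telescope`
        -- both contain `u N`, which is zero.
        convolution-shift : ∀ s N → s < b → suc N ℕ.+ s ≡ p →
          ∑< (suc N) (λ k → u k * v (k ℕ.+ s)) ≈ ∑< N (λ k → u k * v (k ℕ.+ suc s))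
        convolution-shift s N s<b 1+N+s≡p = begin
          ∑< N f + u N * v (N ℕ.+ s)            ≈⟨ +-congˡ uN≈0* ⟩
          ∑< N f + 0#                           ≈⟨ +-congˡ difference≈0 ⟨
          ∑< N f + ∑< N (λ k → u k * (v (suc (k ℕ.+ s)) - v (k ℕ.+ s)))
                                                ≈⟨ split N ⟩
          ∑< N g                                ∎
          where
          f g : ℕ → Carrier
          f k = u k * v (k ℕ.+ s)
          g k = u k * v (k ℕ.+ suc s)
          N<p : N < p
          N<p = ≡.subst (N <_) 1+N+s≡p (s≤s (ℕ.m≤m+n N s))
          -- Both `a + b` and `N + s` equal `p - 1`, and `s < b`.
          a<N : a < N
          a<N = ℕ.+-cancelʳ-< b a N (ℕ.≤-<-trans
            (ℕ.≤-reflexive (ℕ.suc-injective (≡.trans 1+a+b≡p (≡.sym 1+N+s≡p)))) (ℕ.+-monoʳ-< N s<b))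
          uN≈0* : ∀ {w} → u N * w ≈ 0#
          uN≈0* = trans (*-congʳ (ratio-vanish u-ratio a αQᵃ≈1 N a<N N<p)) (zeroˡ _)
          -- The exponent `suc a + s` is positive, and it is below `suc a + b = p` because `s < b`.
          1-βQˢ-unit : 1# - β * Q ^ s ∣ 1#
          1-βQˢ-unit = ∣-respˡ-≈ (+-congˡ (-‿cong (begin
            Q ^ (suc a ℕ.+ s)      ≈⟨ ^-homo-* Q (suc a) s ⟩
            Q ^ suc a * Q ^ s      ≈⟨ *-congʳ β≈Qᵃ⁺¹ ⟨
            β * Q ^ s              ∎)))
            (1-Qʲ-unit (suc a ℕ.+ s) (s≤s z≤n) (≡.subst (suc a ℕ.+ s <_) 1+a+b≡p (s≤s (ℕ.+-monoʳ-< a s<b))))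
          difference≈0 : ∑< N (λ k → u k * (v (suc (k ℕ.+ s)) - v (k ℕ.+ s))) ≈ 0#
          difference≈0 = unit-cancelʳ 1-βQˢ-unit (begin
            ∑< N (λ k → u k * (v (suc (k ℕ.+ s)) - v (k ℕ.+ s))) * (1# - β * Q ^ s)
              ≈⟨ *-comm _ _ ⟩
            (1# - β * Q ^ s) * ∑< N (λ k → u k * (v (suc (k ℕ.+ s)) - v (k ℕ.+ s)))
              ≈⟨ telescope s N (ℕ.≤-reflexive 1+N+s≡p) ⟩
            - (β * Q ^ s) * (1# - Q ^ N) * (u N * v (N ℕ.+ s))
              ≈⟨ *-congˡ uN≈0* ⟩
            - (β * Q ^ s) * (1# - Q ^ N) * 0#
              ≈⟨ trans (zeroʳ _) (sym (zeroˡ _)) ⟩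
            0# * (1# - β * Q ^ s) ∎)
          split : ∀ n → ∑< n f + ∑< n (λ k → u k * (v (suc (k ℕ.+ s)) - v (k ℕ.+ s))) ≈ ∑< n g
          split zero    = +-identityˡ _
          split (suc n) = begin
            ∑< n f + u n * v (n ℕ.+ s) + (h + u n * (v (suc (n ℕ.+ s)) - v (n ℕ.+ s)))
              ≈⟨ solve 5 (λ F h u v v′ → F :+ u :* v :+ (h :+ u :* (v′ :- v)) := F :+ h :+ u :* v′) refl (∑< n f) h (u n) (v (n ℕ.+ s)) (v (suc (n ℕ.+ s))) ⟩
            ∑< n f + h + u n * v (suc (n ℕ.+ s))
              ≈⟨ +-cong (split n) (*-congˡ (reflexive (≡.cong v (≡.sym (ℕ.+-suc n s))))) ⟩
            ∑< n g + g n ∎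
            where h = ∑< n (λ k → u k * (v (suc (k ℕ.+ s)) - v (k ℕ.+ s)))

        -- Induction on the distance `d` from `s` up to `b`. At `s = b` the number of terms is
        -- `suc a`, so for `0 < k ≤ a` the index `k + b` lies strictly between `b` and `p`, the
        -- range in which `v` vanishes.
        convolution≈vᵇ : ∀ d s N → d ℕ.+ s ≡ b → N ℕ.+ s ≡ p →
          ∑< N (λ k → u k * v (k ℕ.+ s)) ≈ v b
        convolution≈vᵇ zero s N ≡.refl N+b≡p = begin
          ∑< N f          ≡⟨ ≡.cong (λ n → ∑< n f) N≡1+a ⟩
          ∑< (suc a) f    ≈⟨ ∑<-head a tail≈0 ⟩
          u 0 * v s       ≈⟨ *-congʳ (ratio-zero u-ratio (ℕ.≤-<-trans z≤n b<p)) ⟩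
          1# * v s        ≈⟨ *-identityˡ _ ⟩
          v s             ∎
          where
          f : ℕ → Carrier
          f k = u k * v (k ℕ.+ s)
          N≡1+a : N ≡ suc a
          N≡1+a = ℕ.+-cancelʳ-≡ s N (suc a) (≡.trans N+b≡p (≡.sym 1+a+b≡p))
          tail≈0 : ∀ k → 0 < k → k ≤ a → f k ≈ 0#
          tail≈0 k 0<k k≤a = trans (*-congˡ (ratio-vanish v-ratio b βQᵇ≈1 (k ℕ.+ s)
            (ℕ.+-monoˡ-< s 0<k) (≡.subst (k ℕ.+ s <_) 1+a+b≡p (s≤s (ℕ.+-monoˡ-≤ s k≤a))))) (zeroʳ _)
        -- An empty sum would force `s = p`, against `s < b < p`.
        convolution≈vᵇ (suc d) s zero 1+d+s≡b s≡p =
          ⊥-elim (ℕ.<-asym b<p (≡.subst (_< b) s≡p (≡.subst (s <_) 1+d+s≡b (s≤s (ℕ.m≤n+m s d)))))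
        convolution≈vᵇ (suc d) s (suc N) 1+d+s≡b 1+N+s≡p = trans
          (convolution-shift s N (≡.subst (s <_) 1+d+s≡b (s≤s (ℕ.m≤n+m s d))) 1+N+s≡p)
          (convolution≈vᵇ d (suc s) N (≡.trans (ℕ.+-suc d s) 1+d+s≡b) (≡.trans (ℕ.+-suc N s) 1+N+s≡p))

        -- The negative power of `Q` is kept on the left as a positive one, since inverses of powers
        -- of `q` become available only in `PrimeOrder`.
        vᵇ-value : v b * Q ^ triangular b ≈ (- 1#) ^ b
        vᵇ-value = unit-cancelʳ (pochhammer-unit b b<p) (begin
          v b * Q ^ triangular b * pochhammer Q Q b
            ≈⟨ solve 3 (λ v T P → v :* T :* P := v :* P :* T) refl (v b) (Q ^ triangular b) (pochhammer Q Q b) ⟩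
          v b * pochhammer Q Q b * Q ^ triangular b
            ≈⟨ *-congʳ (v-ratio b b<p) ⟩
          pochhammer β Q b * Q ^ triangular b
            ≈⟨ pochhammer-reverse b βQᵇ≈1 ⟩
          (- 1#) ^ b * pochhammer Q Q b ∎)

        convolution-value : ∀ s N → s ≤ b → N ℕ.+ s ≡ p →
          ∑< N (λ k → u k * v (k ℕ.+ s)) * Q ^ triangular b ≈ (- 1#) ^ b
        convolution-value s N s≤b N+s≡p =
          trans (*-congʳ (convolution≈vᵇ (b ℕ.∸ s) s N (ℕ.m∸n+n≡m s≤b) N+s≡p)) vᵇ-value

-- Geometric sums and the unit 1 - q

module PowerSums {c ℓ} (R : CommutativeRing c ℓ) where
  open CommutativeRing R
  open Exp semiring using (_^_)
  open Divisibility *-commutativeSemigroup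
    using (_∣_; _,_; ∣-respʳ-≈; x∣ʳy⇒x∣ʳzy)
  open Mult semiring using () renaming (_×_ to _·_)
  open IntegerCoefficients R
  open SetoidReasoning setoid

  1-x∣1-xⁿ : ∀ x n → 1# - x ∣ 1# - x ^ n
  1-x∣1-xⁿ x zero    = 0# , solve 1 (λ x → con ℤ.0ℤ :* (con ℤ.1ℤ :- x) := con ℤ.1ℤ :- con ℤ.1ℤ) refl x
  1-x∣1-xⁿ x (suc n) with k , k[1-x]≈1-xⁿ ← 1-x∣1-xⁿ x n = 1# + x * k , (begin
    (1# + x * k) * (1# - x)            ≈⟨ solve 2 (λ x k → (con ℤ.1ℤ :+ x :* k) :* (con ℤ.1ℤ :- x) := con ℤ.1ℤ :- x :+ x :* (k :* (con ℤ.1ℤ :- x))) refl x k ⟩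
    1# - x + x * (k * (1# - x))        ≈⟨ +-congˡ (*-congˡ k[1-x]≈1-xⁿ) ⟩
    1# - x + x * (1# - x ^ n)          ≈⟨ solve 2 (λ x y → con ℤ.1ℤ :- x :+ x :* (con ℤ.1ℤ :- y) := con ℤ.1ℤ :- x :* y) refl x (x ^ n) ⟩
    1# - x * x ^ n                     ∎)

  -1²ⁿ≈1 : ∀ n → (- 1#) ^ (n ℕ.* 2) ≈ 1#
  -1²ⁿ≈1 zero    = refl
  -1²ⁿ≈1 (suc n) = begin
    - 1# * (- 1# * (- 1#) ^ (n ℕ.* 2))     ≈⟨ solve 1 (λ x → :- con ℤ.1ℤ :* (:- con ℤ.1ℤ :* x) := x) refl _ ⟩
    (- 1#) ^ (n ℕ.* 2)                     ≈⟨ -1²ⁿ≈1 n ⟩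
    1#                                     ∎

  -- Only the Horner recursion of `1 + q + ⋯ + qⁿ⁻¹` is assumed of `g`, so that the coefficient list
  -- `[_]q` can take its place.
  module _ (q : Carrier) (g : ℕ → Carrier) (g₀ : g 0 ≈ 0#) (gₛ : ∀ n → g (suc n) ≈ 1# + q * g n) where

    geometric-sum : ∀ n → (1# - q) * g n ≈ 1# - q ^ n
    geometric-sum zero    = trans (*-congˡ g₀) (solve 1 (λ q → (con ℤ.1ℤ :- q) :* con ℤ.0ℤ := con ℤ.1ℤ :- con ℤ.1ℤ) refl q)
    geometric-sum (suc n) = begin
      (1# - q) * g (suc n)                 ≈⟨ *-congˡ (gₛ n) ⟩
      (1# - q) * (1# + q * g n)            ≈⟨ solve 2 (λ q g → (con ℤ.1ℤ :- q) :* (con ℤ.1ℤ :+ q :* g) := con ℤ.1ℤ :- q :+ q :* ((con ℤ.1ℤ :- q) :* g)) refl q (g n) ⟩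
      1# - q + q * ((1# - q) * g n)        ≈⟨ +-congˡ (*-congˡ (geometric-sum n)) ⟩
      1# - q + q * (1# - q ^ n)            ≈⟨ solve 2 (λ q y → con ℤ.1ℤ :- q :+ q :* (con ℤ.1ℤ :- y) := con ℤ.1ℤ :- q :* y) refl q (q ^ n) ⟩
      1# - q * q ^ n                       ∎

    -- A polynomial in `q` agrees modulo `1 - q` with its value at `q = 1`, which for `g n` is `n`.
    -- The new summand `g n` of the quotient comes from `g n - q * g n = (1 - q) * g n`.
    geometric-sum-at-1 : ∀ n → 1# - q ∣ n · 1# - g n
    geometric-sum-at-1 zero    = 0# , trans (zeroˡ _) (sym (trans (+-congˡ (-‿cong g₀)) (-‿inverseʳ 0#)))
    geometric-sum-at-1 (suc n) with h , h[1-q]≈n-g ← geometric-sum-at-1 n = h + g n , (begin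
      (h + g n) * (1# - q)                     ≈⟨ solve 3 (λ h g q → (h :+ g) :* (con ℤ.1ℤ :- q) := h :* (con ℤ.1ℤ :- q) :+ (g :- q :* g)) refl h (g n) q ⟩
      h * (1# - q) + (g n - q * g n)           ≈⟨ +-congʳ h[1-q]≈n-g ⟩
      n · 1# - g n + (g n - q * g n)           ≈⟨ solve 3 (λ n g q → n :- g :+ (g :- q :* g) := con ℤ.1ℤ :+ n :- (con ℤ.1ℤ :+ q :* g)) refl (n · 1#) (g n) q ⟩
      1# + n · 1# - (1# + q * g n)             ≈⟨ +-congˡ (-‿cong (gₛ n)) ⟨
      1# + n · 1# - g (suc n)                  ∎)

    geometric-root : ∀ n → g n ≈ 0# → q ^ n ≈ 1#
    geometric-root n gₙ≈0 = begin
      q ^ n                     ≈⟨ solve 1 (λ y → y := con ℤ.1ℤ :- (con ℤ.1ℤ :- y)) refl (q ^ n) ⟩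
      1# - (1# - q ^ n)         ≈⟨ +-congˡ (-‿cong (geometric-sum n)) ⟨
      1# - (1# - q) * g n       ≈⟨ +-congˡ (-‿cong (*-congˡ gₙ≈0)) ⟩
      1# - (1# - q) * 0#        ≈⟨ solve 1 (λ x → con ℤ.1ℤ :- x :* con ℤ.0ℤ := con ℤ.1ℤ) refl (1# - q) ⟩
      1#                        ∎

    1-q-unit : ∀ n → g n ≈ 0# → n · 1# ∣ 1# → 1# - q ∣ 1#
    1-q-unit n gₙ≈0 (w , wn≈1) = ∣-respʳ-≈ (begin
      w * (n · 1# - g n)      ≈⟨ *-congˡ (+-congˡ (-‿cong gₙ≈0)) ⟩
      w * (n · 1# - 0#)       ≈⟨ solve 2 (λ w n → w :* (n :- con ℤ.0ℤ) := w :* n) refl w (n · 1#) ⟩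
      w * n · 1#              ≈⟨ wn≈1 ⟩
      1#                      ∎) (x∣ʳy⇒x∣ʳzy w (geometric-sum-at-1 n))

-- Fractions modulo an element of a commutative ring

module BezoutTheory {c ℓ} (R : CommutativeRing c ℓ) where
  open CommutativeRing R
  open Divisibility *-commutativeSemigroup
    using (_∣_; _,_; ∣-respʳ-≈; x∣ʳy⇒x∣ʳzy)
  open RawSemiringDefs (CommutativeSemiring.rawSemiring commutativeSemiring) using (Coprime)
  open IntegerCoefficients R
  open SetoidReasoning setoid

  ∣-+ : ∀ {x y z} → x ∣ y → x ∣ z → x ∣ y + z
  ∣-+ {x} (k , kx≈y) (l , lx≈z) = k + l , trans (distribʳ x k l) (+-cong kx≈y lx≈z)

  ∣-minuend⇒∣-subtrahend : ∀ {x y z} → x ∣ y → x ∣ y - z → x ∣ z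
  ∣-minuend⇒∣-subtrahend {x} {y} {z} (k , kx≈y) (l , lx≈y-z) = k - l , (begin
    (k - l) * x        ≈⟨ solve 3 (λ k l x → (k :- l) :* x := k :* x :- l :* x) refl k l x ⟩
    k * x - l * x      ≈⟨ +-cong kx≈y (-‿cong lx≈y-z) ⟩
    y - (y - z)        ≈⟨ solve 2 (λ y z → y :- (y :- z) := z) refl y z ⟩
    z                  ∎)

  record Bezout (f g : Carrier) : Set (c ⊔ ℓ) where
    field
      d x y    : Carrier
      d∣f      : d ∣ f
      d∣g      : d ∣ g
      identity : x * f + y * g ≈ d

  bezout-zeroˡ : ∀ {f} g → f ≈ 0# → Bezout f g
  bezout-zeroˡ {f} g f≈0 = record
    { d = g ; x = 0# ; y = 1#
    ; d∣f = 0# , trans (zeroˡ g) (sym f≈0)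
    ; d∣g = 1# , *-identityˡ g
    ; identity = solve 2 (λ f g → con ℤ.0ℤ :* f :+ con ℤ.1ℤ :* g := g) refl f g
    }

  bezout-sym : ∀ {f g} → Bezout f g → Bezout g f
  bezout-sym b = record
    { d = d ; x = y ; y = x ; d∣f = d∣g ; d∣g = d∣f ; identity = trans (+-comm _ _) identity }
    where open Bezout b

  bezout-sub : ∀ {f g} k → Bezout f (g - k * f) → Bezout f g
  bezout-sub {f} {g} k b = record
    { d = d ; x = x - y * k ; y = y
    ; d∣f = d∣f
    ; d∣g = ∣-respʳ-≈ (solve 3 (λ f g k → g :- k :* f :+ k :* f := g) refl f g k) (∣-+ d∣g (x∣ʳy⇒x∣ʳzy k d∣f))
    ; identity = trans (solve 5 (λ f g k x y → (x :- y :* k) :* f :+ y :* g := x :* f :+ y :* (g :- k :* f)) refl f g k x y) identity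
    }
    where open Bezout b

  -- The cancelled factor `g` is recorded because divisibility by `M` passes from `n` to `n′` only
  -- once `g` is known to be a unit modulo `M`.
  record Reduction (n d : Carrier) : Set (c ⊔ ℓ) where
    field
      g n′ d′ : Carrier
      gn′≈n   : g * n′ ≈ n
      gd′≈d   : g * d′ ≈ d
      coprime : Coprime n′ d′

    cross : n′ * d ≈ n * d′
    cross = begin
      n′ * d            ≈⟨ *-congˡ gd′≈d ⟨
      n′ * (g * d′)     ≈⟨ solve 3 (λ n g d → n :* (g :* d) := g :* n :* d) refl n′ g d′ ⟩
      g * n′ * d′       ≈⟨ *-congʳ gn′≈n ⟩
      n * d′            ∎

    d′≉0 : ¬ d ≈ 0# → ¬ d′ ≈ 0#
    d′≉0 d≉0 d′≈0 = d≉0 (trans (sym gd′≈d) (trans (*-congˡ d′≈0) (zeroʳ g)))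

  -- Dividing the Bézout identity for `n` and `d` by `g` gives one for `n′` and `d′` with value 1,
  -- hence coprimality. The division is legitimate because `g = 0` would make `d` zero.
  reduction : (∀ x y → x * y ≈ 0# → x ≈ 0# ⊎ y ≈ 0#) →
              ∀ {n d} → ¬ d ≈ 0# → Bezout n d → Reduction n d
  reduction zero-product {n} {d} d≉0 b with Bezout.d∣f b | Bezout.d∣g b
  ... | n′ , n′g≈n | d′ , d′g≈d = record
    { g = g ; n′ = n′ ; d′ = d′ ; gn′≈n = trans (*-comm g n′) n′g≈n ; gd′≈d = trans (*-comm g d′) d′g≈d
    ; coprime = λ z∣n′ z∣d′ → ∣-respʳ-≈ xn′+yd′≈1 (∣-+ (x∣ʳy⇒x∣ʳzy x z∣n′) (x∣ʳy⇒x∣ʳzy y z∣d′))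
    }
    where
    open Bezout b using (x; y; identity) renaming (d to g)
    h = x * n′ + y * d′
    gh≈g : g * h ≈ g
    gh≈g = begin
      g * (x * n′ + y * d′)            ≈⟨ solve 5 (λ g x n y d → g :* (x :* n :+ y :* d) := x :* (n :* g) :+ y :* (d :* g)) refl g x n′ y d′ ⟩
      x * (n′ * g) + y * (d′ * g)      ≈⟨ +-cong (*-congˡ n′g≈n) (*-congˡ d′g≈d) ⟩
      x * n + y * d                    ≈⟨ identity ⟩
      g                                ∎
    g[h-1]≈0 : g * (h - 1#) ≈ 0#
    g[h-1]≈0 = begin
      g * (h - 1#)     ≈⟨ solve 2 (λ g h → g :* (h :- con ℤ.1ℤ) := g :* h :- g) refl g h ⟩
      g * h - g        ≈⟨ +-congʳ gh≈g ⟩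
      g - g            ≈⟨ -‿inverseʳ g ⟩
      0#               ∎
    xn′+yd′≈1 : h ≈ 1#
    xn′+yd′≈1 with zero-product g (h - 1#) g[h-1]≈0
    ... | inj₁ g≈0   = ⊥-elim (d≉0 (trans (sym d′g≈d) (trans (*-congˡ g≈0) (zeroʳ d′))))
    ... | inj₂ h-1≈0 = begin
      h              ≈⟨ solve 1 (λ h → h := h :- con ℤ.1ℤ :+ con ℤ.1ℤ) refl h ⟩
      h - 1# + 1#    ≈⟨ +-congʳ h-1≈0 ⟩
      0# + 1#        ≈⟨ +-identityˡ 1# ⟩
      1#             ∎

module Evaluation {c ℓ} (R : CommutativeRing c ℓ) (M : CommutativeRing.Carrier R) where
  open CommutativeRing R
  open Divisibility *-commutativeSemigroup
    using (_∣_; x∣ʳy⇒x∣ʳzy; ∣ʳ-trans)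
  open RawSemiringDefs (CommutativeSemiring.rawSemiring commutativeSemiring) using (Coprime)
  open BezoutTheory R
  open Quotient R M
  module K = CommutativeRing quotientRing
  open Divisibility K.*-commutativeSemigroup
    using () renaming (_∣_ to _∣ᴷ_; _,_ to _,ᴷ_)
  open QSeries quotientRing using (unit-*; unit-cancelʳ)
  open IntegerCoefficients quotientRing
  open SetoidReasoning K.setoid

  -- The residue class x of the fraction n / d, where d is invertible modulo M.
  record Evaluates (n d x : Carrier) : Set (c ⊔ ℓ) where
    constructor evaluates
    field
      den-unit : d ∣ᴷ 1#
      value    : x * d ~ n

  open Evaluates

  evaluates-+ : ∀ {n₁ d₁ x₁ n₂ d₂ x₂} → Evaluates n₁ d₁ x₁ → Evaluates n₂ d₂ x₂ →
                Evaluates (n₁ * d₂ + n₂ * d₁) (d₁ * d₂) (x₁ + x₂)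
  evaluates-+ {n₁} {d₁} {x₁} {n₂} {d₂} {x₂} e₁ e₂ = evaluates (unit-* (den-unit e₁) (den-unit e₂)) (begin
    (x₁ + x₂) * (d₁ * d₂)              ≈⟨ solve 4 (λ x₁ x₂ d₁ d₂ → (x₁ :+ x₂) :* (d₁ :* d₂) := x₁ :* d₁ :* d₂ :+ x₂ :* d₂ :* d₁) K.refl x₁ x₂ d₁ d₂ ⟩
    x₁ * d₁ * d₂ + x₂ * d₂ * d₁        ≈⟨ K.+-cong (K.*-congʳ (value e₁)) (K.*-congʳ (value e₂)) ⟩
    n₁ * d₂ + n₂ * d₁                  ∎)

  evaluates-* : ∀ {n₁ d₁ x₁ n₂ d₂ x₂} → Evaluates n₁ d₁ x₁ → Evaluates n₂ d₂ x₂ →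
                Evaluates (n₁ * n₂) (d₁ * d₂) (x₁ * x₂)
  evaluates-* {n₁} {d₁} {x₁} {n₂} {d₂} {x₂} e₁ e₂ = evaluates (unit-* (den-unit e₁) (den-unit e₂)) (begin
    x₁ * x₂ * (d₁ * d₂)        ≈⟨ solve 4 (λ x₁ x₂ d₁ d₂ → x₁ :* x₂ :* (d₁ :* d₂) := x₁ :* d₁ :* (x₂ :* d₂)) K.refl x₁ x₂ d₁ d₂ ⟩
    x₁ * d₁ * (x₂ * d₂)        ≈⟨ K.*-cong (value e₁) (value e₂) ⟩
    n₁ * n₂                    ∎)

  evaluates-resp : ∀ {n d x y} → x ~ y → Evaluates n d x → Evaluates n d y
  evaluates-resp x~y (evaluates unit value) = evaluates unit (K.trans (K.*-congʳ (K.sym x~y)) value)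

  evaluates-element : ∀ x → Evaluates x 1# x
  evaluates-element x = evaluates (1# ,ᴷ K.*-identityʳ 1#) (K.*-identityʳ x)

  difference∼0 : ∀ {n₁ d₁ n₂ d₂ x} → Evaluates n₁ d₁ x → Evaluates n₂ d₂ x → n₁ * d₂ - n₂ * d₁ ~ 0#
  difference∼0 {n₁} {d₁} {n₂} {d₂} {x} e₁ e₂ = begin
    n₁ * d₂ - n₂ * d₁              ≈⟨ K.+-cong (K.*-congʳ (value e₁)) (K.-‿cong (K.*-congʳ (value e₂))) ⟨
    x * d₁ * d₂ - x * d₂ * d₁      ≈⟨ solve 3 (λ x y z → x :* y :* z :- x :* z :* y := con ℤ.0ℤ) K.refl x d₁ d₂ ⟩
    0#                             ∎

  unit-factor : ∀ {d g d′} → g * d′ ≈ d → d ∣ᴷ 1# → g ∣ᴷ 1#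
  unit-factor {d} {g} {d′} gd′≈d (y ,ᴷ yd~1) = y * d′ ,ᴷ (begin
    y * d′ * g      ≈⟨ solve 3 (λ y d′ g → y :* d′ :* g := y :* (g :* d′)) K.refl y d′ g ⟩
    y * (g * d′)    ≈⟨ K.*-congˡ (≈⇒~ gd′≈d) ⟩
    y * d           ≈⟨ yd~1 ⟩
    1#              ∎)

  -- A common divisor of `d` and `M` divides both `y * d` and `y * d - 1`, hence 1.
  unit⇒coprime : ∀ {d} → d ∣ᴷ 1# → Coprime d M
  unit⇒coprime {d} (y ,ᴷ yd~1) z∣d z∣M = ∣-minuend⇒∣-subtrahend (x∣ʳy⇒x∣ʳzy y z∣d) (∣ʳ-trans z∣M yd~1)

  module _ {n d} (red : Reduction n d) where
    open Reduction red

    -- A factor of a unit is a unit, so `d′` inherits invertibility modulo `M` from `d`.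
    reduced-den-coprime : d ∣ᴷ 1# → Coprime d′ M
    reduced-den-coprime d-unit = unit⇒coprime (unit-factor (trans (*-comm d′ g) gd′≈d) d-unit)

    -- The cancelled `g` is also a factor of the unit `d`, so it can be cancelled from
    -- `g * n′ ~ 0#`.
    reduced-num-divisible : d ∣ᴷ 1# → n ~ 0# → M ∣ n′
    reduced-num-divisible d-unit n~0 = ~0⇒∣ (unit-cancelʳ (unit-factor gd′≈d d-unit) (begin
      n′ * g     ≈⟨ K.*-comm n′ g ⟩
      g * n′     ≈⟨ ≈⇒~ gn′≈n ⟩
      n          ≈⟨ n~0 ⟩
      0#         ≈⟨ K.zeroˡ g ⟨
      0# * g     ∎))

-- Congruences between integers and residues of rational numbers

module _ where
  open ≡ using (refl; sym; trans; cong; cong₂; subst)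
  open IntegerCoefficients ℤ.+-*-commutativeRing

  prime-∤⇒coprime : ∀ {p m} → Prime p → p ∤ m → ℕ.Coprime m p
  prime-∤⇒coprime p-prime p∤m (d∣m , d∣p) with prime⇒irreducible p-prime d∣p
  ... | inj₁ d≡1 = d≡1
  ... | inj₂ refl = ⊥-elim (p∤m d∣m)

  euclid : ∀ {p} i j → Prime p → + p ℤ.∣ i ℤ.* j → + p ℤ.∣ i ⊎ + p ℤ.∣ j
  euclid i j p-prime p∣ij with euclidsLemma ℤ.∣ i ∣ ℤ.∣ j ∣ p-prime (subst (_ ℕ.∣_) (ℤ.abs-* i j) (ℤ.∣⇒∣ᵤ p∣ij))
  ... | inj₁ p∣i = inj₁ (ℤ.∣ᵤ⇒∣ p∣i)
  ... | inj₂ p∣j = inj₂ (ℤ.∣ᵤ⇒∣ p∣j)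

  euclid-∤ : ∀ {p m} j → Prime p → p ∤ m → + p ℤ.∣ + m ℤ.* j → + p ℤ.∣ j
  euclid-∤ {m = m} j p-prime p∤m p∣mj = [ (λ p∣m → ⊥-elim (p∤m (ℤ.∣⇒∣ᵤ p∣m))) , (λ p∣j → p∣j) ]′ (euclid (+ m) j p-prime p∣mj)

  inverse-mod : ∀ {p m} → Prime p → p ∤ m → ∃[ y ] + p ℤ.∣ + m ℤ.* y ℤ.- + 1
  inverse-mod {p} {m} p-prime p∤m with ℕ.coprime-Bézout (prime-∤⇒coprime p-prime p∤m)
  ... | Bézout.+- x y 1+yp≡xm = + x , ℤ.divides (+ y) (begin
    + m ℤ.* + x ℤ.- + 1                ≡⟨ cong (ℤ._- + 1) (ℤ.*-comm (+ m) (+ x)) ⟩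
    + x ℤ.* + m ℤ.- + 1                ≡⟨ cong (ℤ._- + 1) (ℤ.pos-* x m) ⟨
    + (x ℕ.* m) ℤ.- + 1                ≡⟨ cong (λ n → + n ℤ.- + 1) 1+yp≡xm ⟨
    + 1 ℤ.+ + (y ℕ.* p) ℤ.- + 1        ≡⟨ cong (λ i → + 1 ℤ.+ i ℤ.- + 1) (ℤ.pos-* y p) ⟩
    + 1 ℤ.+ + y ℤ.* + p ℤ.- + 1        ≡⟨ solve 1 (λ i → con ℤ.1ℤ :+ i :- con ℤ.1ℤ := i) refl (+ y ℤ.* + p) ⟩
    + y ℤ.* + p                        ∎)
    where open ≡.≡-Reasoning
  ... | Bézout.-+ x y 1+xm≡yp = ℤ.- + x , ℤ.divides (ℤ.- + y) (begin
    + m ℤ.* ℤ.- + x ℤ.- + 1            ≡⟨ solve 2 (λ m x → m :* :- x :- con ℤ.1ℤ := :- (con ℤ.1ℤ :+ x :* m)) refl (+ m) (+ x) ⟩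
    ℤ.- (+ 1 ℤ.+ + x ℤ.* + m)          ≡⟨ cong (λ i → ℤ.- (+ 1 ℤ.+ i)) (ℤ.pos-* x m) ⟨
    ℤ.- + (1 ℕ.+ x ℕ.* m)              ≡⟨ cong (λ n → ℤ.- + n) 1+xm≡yp ⟩
    ℤ.- + (y ℕ.* p)                    ≡⟨ cong ℤ.-_ (ℤ.pos-* y p) ⟩
    ℤ.- (+ y ℤ.* + p)                  ≡⟨ ℤ.neg-distribˡ-* (+ y) (+ p) ⟩
    ℤ.- + y ℤ.* + p                    ∎)
    where open ≡.≡-Reasoning

  linear-congruence′ : ∀ {p m} → Prime p → p ∤ m → ∀ n → ∃[ x ] x < p × + p ℤ.∣ + m ℤ.* + x ℤ.- n
  linear-congruence′ {p} {m} p-prime p∤m n with inverse-mod p-prime p∤m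
  ... | y , ℤ.divides k my-1≡kp = (y ℤ.* n) %ℕ p , n%ℕd<d (y ℤ.* n) p , ℤ.divides (n ℤ.* k ℤ.- + m ℤ.* t) (begin
    + m ℤ.* + x ℤ.- n
      ≡⟨ solve 5 (λ m x n t p → m :* x :- n := m :* (x :+ t :* p) :- n :- m :* t :* p) refl (+ m) (+ x) n t (+ p) ⟩
    + m ℤ.* (+ x ℤ.+ t ℤ.* + p) ℤ.- n ℤ.- + m ℤ.* t ℤ.* + p
      ≡⟨ cong (λ i → + m ℤ.* i ℤ.- n ℤ.- + m ℤ.* t ℤ.* + p) (a≡a%ℕn+[a/ℕn]*n (y ℤ.* n) p) ⟨
    + m ℤ.* (y ℤ.* n) ℤ.- n ℤ.- + m ℤ.* t ℤ.* + p
      ≡⟨ solve 5 (λ m y n t p → m :* (y :* n) :- n :- m :* t :* p := n :* (m :* y :- con ℤ.1ℤ) :- m :* t :* p) refl (+ m) y n t (+ p) ⟩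
    n ℤ.* (+ m ℤ.* y ℤ.- + 1) ℤ.- + m ℤ.* t ℤ.* + p
      ≡⟨ cong (λ i → n ℤ.* i ℤ.- + m ℤ.* t ℤ.* + p) my-1≡kp ⟩
    n ℤ.* (k ℤ.* + p) ℤ.- + m ℤ.* t ℤ.* + p
      ≡⟨ solve 5 (λ m k n t p → n :* (k :* p) :- m :* t :* p := (n :* k :- m :* t) :* p) refl (+ m) k n t (+ p) ⟩
    (n ℤ.* k ℤ.- + m ℤ.* t) ℤ.* + p ∎)
    where
    open ≡.≡-Reasoning
    instance _ = prime⇒nonZero p-prime
    x = (y ℤ.* n) %ℕ p
    t = (y ℤ.* n) /ℕ p

  -- Unfolding the witness in conversion checks would run the Euclidean algorithm on open terms.
  abstract
    linear-congruence : ∀ {p m} → Prime p → p ∤ m → ∀ n → ∃[ x ] x < p × + p ℤ.∣ + m ℤ.* + x ℤ.- n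
    linear-congruence = linear-congruence′

  ∈⇒fromMaybe-head∈ : ∀ {A : Set} {x : A} d {xs} → x ∈ xs → fromMaybe d (head xs) ∈ xs
  ∈⇒fromMaybe-head∈ d {_ ∷ _} _ = here refl

  -- One known hit suffices to keep the search in `⟨_⟩[_]` from returning its default, whichever hit
  -- comes first.
  head-filter : ∀ {A : Set} {P : A → Set} (P? : Decidable P) {d x xs} → x ∈ xs → P x →
                let y = fromMaybe d (head (filter P? xs)) in y ∈ xs × P y
  head-filter P? {d} x∈xs Px = ∈-filter⁻ P? (∈⇒fromMaybe-head∈ d (∈-filter⁺ P? x∈xs Px))

  cross-multiply : ∀ x {z} → ℚ.toℚᵘ x ℚᵘ.≃ z → ↥ x ℤ.* ℚᵘ.↧ z ≡ ℚᵘ.↥ z ℤ.* ↧ x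
  cross-multiply (mkℚ _ _ _) (ℚᵘ.*≡* eq) = eq

  numerator-coprime : ∀ x → ℕ.Coprime ℤ.∣ ↥ x ∣ (↧ₙ x)
  numerator-coprime (mkℚ _ _ isCoprime) = ℕ.recompute isCoprime

  -- By Euclid's lemma `p` divides `n` or the denominator of `x`; the latter is impossible because
  -- `x` is stored in lowest terms.
  ∣↥⇒∣numerator : ∀ {p} → Prime p → ∀ m x {n} → ↥ x ℤ.* + m ≡ n ℤ.* ↧ x → p ℕ.∣ ℤ.∣ ↥ x ∣ → + p ℤ.∣ n
  ∣↥⇒∣numerator {p} p-prime m x {n} xm≡n p∣↥x
    with euclid n (↧ x) p-prime (subst (+ p ℤ.∣_) xm≡n (ℤ.∣m⇒∣m*n {m = ↥ x} (+ m) (ℤ.∣ᵤ⇒∣ p∣↥x)))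
  ... | inj₁ p∣n  = p∣n
  ... | inj₂ p∣↧x = ⊥-elim (ℕ.nonTrivial⇒≢1 {{prime⇒nonTrivial p-prime}}
                             (numerator-coprime x (p∣↥x , ℤ.∣⇒∣ᵤ p∣↧x)))

  ∣numerator⇒∣↥ : ∀ {p m} → Prime p → p ∤ m → ∀ x {n} → ↥ x ℤ.* + m ≡ n ℤ.* ↧ x → + p ℤ.∣ n → p ℕ.∣ ℤ.∣ ↥ x ∣
  ∣numerator⇒∣↥ {p} {m} p-prime p∤m x {n} xm≡n p∣n = ℤ.∣⇒∣ᵤ (euclid-∤ (↥ x) p-prime p∤m
    (subst (+ p ℤ.∣_) (trans (sym xm≡n) (ℤ.*-comm (↥ x) (+ m))) (ℤ.∣m⇒∣m*n {m = n} (↧ x) p∣n)))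

  module _ {p m-1} (p-prime : Prime p) (p∤m : p ∤ suc m-1) (x : ℚ) (n : ℤ) (x≃n/m : ℚ.toℚᵘ x ℚᵘ.≃ mkℚᵘ n m-1) where

    private m = suc m-1

    -- Unnormalised fractions have numerators that can be read off, whereas the normalisation in `ℚ`
    -- hides them.
    difference≃ : ∀ a → ℚ.toℚᵘ (x ℚ.- (+ a) ℚ./ 1) ℚᵘ.≃ mkℚᵘ n m-1 ℚᵘ.- mkℚᵘ (+ a) 0
    difference≃ a = begin
      ℚ.toℚᵘ (x ℚ.- (+ a) ℚ./ 1)                         ≈⟨ ℚ.toℚᵘ-homo-+ x (ℚ.- ((+ a) ℚ./ 1)) ⟩
      ℚ.toℚᵘ x ℚᵘ.+ ℚ.toℚᵘ (ℚ.- ((+ a) ℚ./ 1))           ≈⟨ ℚᵘ.+-cong x≃n/m (ℚ.toℚᵘ-homo‿- ((+ a) ℚ./ 1)) ⟩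
      mkℚᵘ n m-1 ℚᵘ.+ ℚᵘ.- ℚ.toℚᵘ ((+ a) ℚ./ 1)          ≈⟨ ℚᵘ.+-congʳ (mkℚᵘ n m-1) (ℚᵘ.-‿cong (ℚ.toℚᵘ-fromℚᵘ (mkℚᵘ (+ a) 0))) ⟩
      mkℚᵘ n m-1 ℚᵘ.- mkℚᵘ (+ a) 0                       ∎
      where open ℚᵘ.≃-Reasoning

    difference-numerator : ∀ a → let y = x ℚ.- (+ a) ℚ./ 1 in ↥ y ℤ.* + m ≡ (n ℤ.- + m ℤ.* + a) ℤ.* ↧ y
    difference-numerator a = begin
      ↥ y ℤ.* + m                                      ≡⟨ cong (λ k → ↥ y ℤ.* + k) (ℕ.*-identityʳ m) ⟨
      ↥ y ℤ.* + (m ℕ.* 1)                              ≡⟨ cross-multiply y (difference≃ a) ⟩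
      (n ℤ.* + 1 ℤ.+ (ℤ.- + a) ℤ.* + m) ℤ.* ↧ y        ≡⟨ cong (ℤ._* ↧ y) (solve 3 (λ n a m → n :* con ℤ.1ℤ :+ (:- a) :* m := n :- m :* a) refl n (+ a) (+ m)) ⟩
      (n ℤ.- + m ℤ.* + a) ℤ.* ↧ y                      ∎
      where
      open ≡.≡-Reasoning
      y = x ℚ.- (+ a) ℚ./ 1

    numerator-∣⇒ : ∀ a → p ℕ.∣ ℤ.∣ ↥ (x ℚ.- (+ a) ℚ./ 1) ∣ → + p ℤ.∣ + m ℤ.* + a ℤ.- n
    numerator-∣⇒ a p∣↥y = subst (+ p ℤ.∣_) (solve 2 (λ n k → :- (n :- k) := k :- n) refl n (+ m ℤ.* + a))
      (ℤ.∣m⇒∣-m {m = n ℤ.- + m ℤ.* + a} (∣↥⇒∣numerator p-prime m (x ℚ.- (+ a) ℚ./ 1) (difference-numerator a) p∣↥y))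

    numerator-∣⇐ : ∀ a → + p ℤ.∣ + m ℤ.* + a ℤ.- n → p ℕ.∣ ℤ.∣ ↥ (x ℚ.- (+ a) ℚ./ 1) ∣
    numerator-∣⇐ a p∣ma-n = ∣numerator⇒∣↥ p-prime p∤m (x ℚ.- (+ a) ℚ./ 1) (difference-numerator a)
      (subst (+ p ℤ.∣_) (solve 2 (λ n k → :- (k :- n) := n :- k) refl n (+ m ℤ.* + a)) (ℤ.∣m⇒∣-m {m = + m ℤ.* + a ℤ.- n} p∣ma-n))

    residue-spec : ⟨ x ⟩[ p ] < p × + p ℤ.∣ + m ℤ.* + ⟨ x ⟩[ p ] ℤ.- n
    residue-spec = ∈-upTo⁻ (proj₁ residue∈) , numerator-∣⇒ ⟨ x ⟩[ p ] (proj₂ residue∈)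
      where
      P : ℕ → Set
      P a = p ℕ.∣ ℤ.∣ ↥ (x ℚ.- (+ a) ℚ./ 1) ∣
      solution = linear-congruence p-prime p∤m n
      residue∈ : ⟨ x ⟩[ p ] ∈ upTo p × P ⟨ x ⟩[ p ]
      residue∈ = head-filter {P = P} (λ a → p ∣? ℤ.∣ ↥ (x ℚ.- (+ a) ℚ./ 1) ∣) {0}
        (∈-upTo⁺ (proj₁ (proj₂ solution))) (numerator-∣⇐ (proj₁ solution) (proj₂ (proj₂ solution)))

  -- Powers have natural exponents, so a congruence has to become the addition of a multiple of `p`
  -- to the smaller side.
  congruent⇒offset : ∀ {p} i j → + p ℤ.∣ + i ℤ.- + j → (∃[ k ] i ≡ j ℕ.+ k ℕ.* p) ⊎ (∃[ k ] j ≡ i ℕ.+ k ℕ.* p)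
  congruent⇒offset {p} i j (ℤ.divides (+ k) i-j≡kp) = inj₁ (k , ℤ.+-injective (begin
    + i                          ≡⟨ solve 2 (λ i j → i := j :+ (i :- j)) refl (+ i) (+ j) ⟩
    + j ℤ.+ (+ i ℤ.- + j)        ≡⟨ cong (λ x → + j ℤ.+ x) (trans i-j≡kp (sym (ℤ.pos-* k p))) ⟩
    + (j ℕ.+ k ℕ.* p)            ∎))
    where open ≡.≡-Reasoning
  congruent⇒offset {p} i j (ℤ.divides -[1+ k ] i-j≡kp) = inj₂ (suc k , ℤ.+-injective (begin
    + j                                ≡⟨ solve 2 (λ i j → j := i :- (i :- j)) refl (+ i) (+ j) ⟩
    + i ℤ.- (+ i ℤ.- + j)              ≡⟨ cong (λ x → + i ℤ.- x) i-j≡kp ⟩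
    + i ℤ.- -[1+ k ] ℤ.* + p           ≡⟨ cong (λ x → + i ℤ.+ x) (trans (ℤ.neg-distribˡ-* -[1+ k ] (+ p)) (sym (ℤ.pos-* (suc k) p))) ⟩
    + (i ℕ.+ suc k ℕ.* p)              ∎))
    where open ≡.≡-Reasoning

  pos-∸ : ∀ {m n} → n ≤ m → + (m ℕ.∸ n) ≡ + m ℤ.- + n
  pos-∸ {m} {n} n≤m = trans (sym (ℤ.⊖-≥ n≤m)) (sym (ℤ.m-n≡m⊖n m n))

  residue-of-neg : ∀ {p m-1} → Prime p → p ∤ suc m-1 → ∀ z →
    let a = ⟨ ℚ.- (z ℚ./ suc m-1) ⟩[ p ] in a < p × + p ℤ.∣ + suc m-1 ℤ.* + a ℤ.- ℤ.- z
  residue-of-neg {m-1 = m-1} p-prime p∤m z =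
    residue-spec p-prime p∤m (ℚ.- (z ℚ./ suc m-1)) (ℤ.- z)
      (ℚᵘ.≃-trans (ℚ.toℚᵘ-homo‿- (z ℚ./ suc m-1)) (ℚᵘ.-‿cong (ℚ.toℚᵘ-fromℚᵘ (mkℚᵘ z m-1))))

  parity : ∀ n → (∃[ h ] n ≡ h ℕ.* 2) ⊎ (∃[ h ] n ≡ suc (h ℕ.* 2))
  parity zero    = inj₁ (0 , refl)
  parity (suc n) with parity n
  ... | inj₁ (h , refl) = inj₂ (h , refl)
  ... | inj₂ (h , refl) = inj₁ (suc h , refl)

  odd⇒suc-double : ∀ {n} → 2 ∤ n → ∃[ h ] n ≡ suc (h ℕ.* 2)
  odd⇒suc-double {n} 2∤n with parity n
  ... | inj₁ (h , n≡2h) = ⊥-elim (2∤n (divides h n≡2h))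
  ... | inj₂ half       = half

  odd-prime-∤2 : ∀ {p} → Prime p → 2 ∤ p → p ∤ 2
  odd-prime-∤2 {p} p-prime 2∤p p∣2 =
    2∤p (ℕ.∣-reflexive (ℕ.≤-antisym (ℕ.nonTrivial⇒n>1 p {{prime⇒nonTrivial p-prime}}) (ℕ.∣⇒≤ p∣2)))

  -- Adding the two congruences cancels `r` and leaves `p ∣ m (1 + a + b)`. As `0 < 1 + a + b < 2p`,
  -- the only multiple of `p` available is `p` itself.
  residues-complementary : ∀ {p m a b} r → Prime p → p ∤ m → a < p → b < p →
    + p ℤ.∣ + m ℤ.* + a ℤ.- ℤ.- r → + p ℤ.∣ + m ℤ.* + b ℤ.- ℤ.- (+ m ℤ.- r) → suc (a ℕ.+ b) ≡ p
  residues-complementary {p} {m} {a} {b} r p-prime p∤m a<p b<p p∣ma+r p∣mb+m-r = only-multiple (ℤ.∣⇒∣ᵤ p∣1+a+b)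
    where
    p∣1+a+b : + p ℤ.∣ + suc (a ℕ.+ b)
    p∣1+a+b = euclid-∤ (+ suc (a ℕ.+ b)) p-prime p∤m (subst (+ p ℤ.∣_)
      (solve 4 (λ m a b r → (m :* a :- :- r) :+ (m :* b :- :- (m :- r)) := m :* (con ℤ.1ℤ :+ (a :+ b))) refl (+ m) (+ a) (+ b) r)
      (ℤ.∣m∣n⇒∣m+n p∣ma+r p∣mb+m-r))
    only-multiple : p ℕ.∣ suc (a ℕ.+ b) → suc (a ℕ.+ b) ≡ p
    only-multiple (divides 1 eq) = trans eq (ℕ.*-identityˡ p)
    only-multiple (divides (suc (suc k)) eq) = ⊥-elim (ℕ.<-irrefl eq (ℕ.<-≤-trans
      (ℕ.+-mono-≤-< a<p b<p) (ℕ.≤-trans (ℕ.m≤m+n (p ℕ.+ p) (k ℕ.* p)) (ℕ.≤-reflexive (ℕ.+-assoc p p (k ℕ.* p))))))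

  -- Exponents of q modulo p

  triangular-double : ∀ n → triangular n ℕ.* 2 ≡ n ℕ.* (n ℕ.+ 1)
  triangular-double zero    = refl
  triangular-double (suc n) = begin
    (suc n ℕ.+ triangular n) ℕ.* 2             ≡⟨ ℕ.*-distribʳ-+ 2 (suc n) (triangular n) ⟩
    suc n ℕ.* 2 ℕ.+ triangular n ℕ.* 2         ≡⟨ cong (suc n ℕ.* 2 ℕ.+_) (trans (triangular-double n) (trans (ℕ.*-comm n (n ℕ.+ 1)) (cong (ℕ._* n) (ℕ.+-comm n 1)))) ⟩
    suc n ℕ.* 2 ℕ.+ suc n ℕ.* n                ≡⟨ ℕ.*-distribˡ-+ (suc n) 2 n ⟨
    suc n ℕ.* suc (suc n)                      ≡⟨ cong (suc n ℕ.*_) (ℕ.+-comm 1 (suc n)) ⟩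
    suc n ℕ.* (suc n ℕ.+ 1)                    ∎
    where open ≡.≡-Reasoning

  double-triangularℤ : ∀ n → + 2 ℤ.* + triangular n ≡ + n ℤ.* (+ n ℤ.+ + 1)
  double-triangularℤ n = begin
    + 2 ℤ.* + triangular n       ≡⟨ ℤ.*-comm (+ 2) (+ triangular n) ⟩
    + triangular n ℤ.* + 2       ≡⟨ ℤ.pos-* (triangular n) 2 ⟨
    + (triangular n ℕ.* 2)       ≡⟨ cong +_ (triangular-double n) ⟩
    + (n ℕ.* (n ℕ.+ 1))          ≡⟨ ℤ.pos-* n (n ℕ.+ 1) ⟩
    + n ℤ.* (+ n ℤ.+ + 1)        ∎
    where open ≡.≡-Reasoning

  -- The truncating division in the exponent of the theorem is exact, because `a (a + 1)` is twice a
  -- triangular number.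
  half-product : ∀ m a → m ℕ.* (a ℕ.* (a ℕ.+ 1)) ℕ./ 2 ≡ m ℕ.* triangular a
  half-product m a = begin
    m ℕ.* (a ℕ.* (a ℕ.+ 1)) ℕ./ 2         ≡⟨ cong (λ x → m ℕ.* x ℕ./ 2) (triangular-double a) ⟨
    m ℕ.* (triangular a ℕ.* 2) ℕ./ 2      ≡⟨ cong (ℕ._/ 2) (ℕ.*-assoc m (triangular a) 2) ⟨
    m ℕ.* triangular a ℕ.* 2 ℕ./ 2        ≡⟨ m*n/n≡m (m ℕ.* triangular a) 2 ⟩
    m ℕ.* triangular a                    ∎
    where open ≡.≡-Reasoning

  -- Twice the sum is `m (b (b + 1) - a (a + 1)) = m (b - a) (1 + a +
  -- b)`, a multiple of `p`, and the factor 2 cancels for odd `p`. This replaces `b` by `a` in the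
  -- exponent.
  exponent-triangular : ∀ {p a b} m → Prime p → p ∤ 2 → suc (a ℕ.+ b) ≡ p →
    + p ℤ.∣ ℤ.- + (m ℕ.* (a ℕ.* (a ℕ.+ 1)) ℕ./ 2) ℤ.+ + (m ℕ.* triangular b)
  exponent-triangular {p} {a} {b} m p-prime p∤2 1+a+b≡p = euclid-∤ _ p-prime p∤2
    (ℤ.divides (+ m ℤ.* (+ b ℤ.- + a)) (begin
    + 2 ℤ.* (ℤ.- + (m ℕ.* (a ℕ.* (a ℕ.+ 1)) ℕ./ 2) ℤ.+ + (m ℕ.* triangular b))
      ≡⟨ cong₂ (λ x y → + 2 ℤ.* (ℤ.- x ℤ.+ y)) (trans (cong +_ (half-product m a)) (ℤ.pos-* m (triangular a))) (ℤ.pos-* m (triangular b)) ⟩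
    + 2 ℤ.* (ℤ.- (+ m ℤ.* + triangular a) ℤ.+ + m ℤ.* + triangular b)
      ≡⟨ solve 4 (λ t m x y → t :* (:- (m :* x) :+ m :* y) := m :* (t :* y :- t :* x)) refl (+ 2) (+ m) (+ triangular a) (+ triangular b) ⟩
    + m ℤ.* (+ 2 ℤ.* + triangular b ℤ.- + 2 ℤ.* + triangular a)
      ≡⟨ cong₂ (λ x y → + m ℤ.* (x ℤ.- y)) (double-triangularℤ b) (double-triangularℤ a) ⟩
    + m ℤ.* (+ b ℤ.* (+ b ℤ.+ + 1) ℤ.- + a ℤ.* (+ a ℤ.+ + 1))
      ≡⟨ solve 3 (λ m a b → m :* (b :* (b :+ con ℤ.1ℤ) :- a :* (a :+ con ℤ.1ℤ)) := m :* (b :- a) :* (con ℤ.1ℤ :+ (a :+ b))) refl (+ m) (+ a) (+ b) ⟩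
    + m ℤ.* (+ b ℤ.- + a) ℤ.* + suc (a ℕ.+ b)
      ≡⟨ cong (λ n → + m ℤ.* (+ b ℤ.- + a) ℤ.* + n) 1+a+b≡p ⟩
    + m ℤ.* (+ b ℤ.- + a) ℤ.* + p ∎))
    where open ≡.≡-Reasoning

  -- After multiplication by `2m`, which is invertible modulo `p`, the claim is
  -- `r (m - r) + m b (m b + m) ≡ 0`. Since `m b ≡ r - m`, the second summand is congruent to
  -- `(r - m) r`.
  exponent-quadratic : ∀ {p m b} r e → Prime p → p ∤ 2 → p ∤ m →
    + p ℤ.∣ + m ℤ.* + b ℤ.- ℤ.- (+ m ℤ.- r) →
    (+ 2 ℤ.* + m) ℤ.* e ≡ (r ℤ.* (+ m ℤ.- r)) ℤ.* (+ 1 ℤ.- + p ℤ.* + p) →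
    + p ℤ.∣ e ℤ.+ + (m ℕ.* triangular b)
  exponent-quadratic {p} {m} {b} r e p-prime p∤2 p∤m (ℤ.divides k y≡kp) 2me≡ =
    euclid-∤ _ p-prime p∤m (euclid-∤ (+ m ℤ.* (e ℤ.+ + (m ℕ.* triangular b))) p-prime p∤2
    (ℤ.divides (k ℤ.* (k ℤ.* + p ℤ.+ (r ℤ.+ r ℤ.- + m)) ℤ.- r ℤ.* (+ m ℤ.- r) ℤ.* + p) (begin
    + 2 ℤ.* (+ m ℤ.* (e ℤ.+ + (m ℕ.* triangular b)))
      ≡⟨ cong (λ x → + 2 ℤ.* (+ m ℤ.* (e ℤ.+ x))) (ℤ.pos-* m (triangular b)) ⟩
    + 2 ℤ.* (+ m ℤ.* (e ℤ.+ + m ℤ.* + triangular b))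
      ≡⟨ solve 4 (λ t m e x → t :* (m :* (e :+ m :* x)) := t :* m :* e :+ m :* m :* (t :* x)) refl (+ 2) (+ m) e (+ triangular b) ⟩
    + 2 ℤ.* + m ℤ.* e ℤ.+ + m ℤ.* + m ℤ.* (+ 2 ℤ.* + triangular b)
      ≡⟨ cong₂ (λ x y → x ℤ.+ + m ℤ.* + m ℤ.* y) 2me≡ (double-triangularℤ b) ⟩
    r ℤ.* (+ m ℤ.- r) ℤ.* (+ 1 ℤ.- + p ℤ.* + p) ℤ.+ + m ℤ.* + m ℤ.* (+ b ℤ.* (+ b ℤ.+ + 1))
      -- With `y = m b + m - r` one has `m b (m b + m) = (y - (m - r)) (y + r)`; its constant term
      -- `- r (m - r)` cancels, and every remaining term contains `y` or `p`.
      ≡⟨ solve 4 (λ m r b p → r :* (m :- r) :* (con ℤ.1ℤ :- p :* p) :+ m :* m :* (b :* (b :+ con ℤ.1ℤ))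
                   := (m :* b :- :- (m :- r)) :* (m :* b :- :- (m :- r) :+ (r :+ r :- m)) :- r :* (m :- r) :* p :* p) refl (+ m) r (+ b) (+ p) ⟩
    y ℤ.* (y ℤ.+ (r ℤ.+ r ℤ.- + m)) ℤ.- r ℤ.* (+ m ℤ.- r) ℤ.* + p ℤ.* + p
      ≡⟨ cong (λ x → x ℤ.* (x ℤ.+ (r ℤ.+ r ℤ.- + m)) ℤ.- r ℤ.* (+ m ℤ.- r) ℤ.* + p ℤ.* + p) y≡kp ⟩
    k ℤ.* + p ℤ.* (k ℤ.* + p ℤ.+ (r ℤ.+ r ℤ.- + m)) ℤ.- r ℤ.* (+ m ℤ.- r) ℤ.* + p ℤ.* + p
      ≡⟨ solve 4 (λ k p c d → k :* p :* (k :* p :+ c) :- d :* p :* p := (k :* (k :* p :+ c) :- d :* p) :* p) refl k (+ p) (r ℤ.+ r ℤ.- + m) (r ℤ.* (+ m ℤ.- r)) ⟩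
    (k ℤ.* (k ℤ.* + p ℤ.+ (r ℤ.+ r ℤ.- + m)) ℤ.- r ℤ.* (+ m ℤ.- r) ℤ.* + p) ℤ.* + p ∎)))
    where
    open ≡.≡-Reasoning
    y = + m ℤ.* + b ℤ.- ℤ.- (+ m ℤ.- r)

  -- In `p² - 1 = (p - 1) (p + 1)` one factor is divisible by `m` and the other is even. With
  -- `p = 2h + 1`, half of the even factor is `h + 1` or `h`.
  exponent-exists : ∀ {p m} d → 2 ∤ p → m ℕ.∣ p ℕ.∸ 1 ⊎ m ℕ.∣ p ℕ.+ 1 →
    ∃[ e ] (+ 2 ℤ.* + m) ℤ.* e ≡ d ℤ.* (+ 1 ℤ.- + p ℤ.* + p)
  exponent-exists {m = m} d 2∤p m∣p±1 with h , refl ← odd⇒suc-double 2∤p = scale (factor m∣p±1)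
    where
    open ≡.≡-Reasoning
    p = suc (h ℕ.* 2)
    factor : m ℕ.∣ h ℕ.* 2 ⊎ m ℕ.∣ p ℕ.+ 1 → ∃[ t ] (+ 2 ℤ.* + m) ℤ.* t ≡ + p ℤ.* + p ℤ.- + 1
    factor (inj₁ (divides c 2h≡cm)) = + c ℤ.* (+ h ℤ.+ + 1) , (begin
      (+ 2 ℤ.* + m) ℤ.* (+ c ℤ.* (+ h ℤ.+ + 1))
        ≡⟨ solve 4 (λ t m c h → t :* m :* (c :* (h :+ con ℤ.1ℤ)) := c :* m :* (h :* t :+ t)) refl (+ 2) (+ m) (+ c) (+ h) ⟩
      + c ℤ.* + m ℤ.* (+ h ℤ.* + 2 ℤ.+ + 2)
        ≡⟨ cong₂ (λ x y → x ℤ.* (y ℤ.+ + 2)) (trans (sym (ℤ.pos-* c m)) (cong +_ (sym 2h≡cm))) (sym (ℤ.pos-* h 2)) ⟩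
      + (h ℕ.* 2) ℤ.* (+ (h ℕ.* 2) ℤ.+ + 2)
        ≡⟨ solve 1 (λ x → x :* (x :+ con (+ 2)) := (con ℤ.1ℤ :+ x) :* (con ℤ.1ℤ :+ x) :- con ℤ.1ℤ) refl (+ (h ℕ.* 2)) ⟩
      + p ℤ.* + p ℤ.- + 1 ∎)
    factor (inj₂ (divides c p+1≡cm)) = + c ℤ.* + h , (begin
      (+ 2 ℤ.* + m) ℤ.* (+ c ℤ.* + h)
        ≡⟨ solve 4 (λ t m c h → t :* m :* (c :* h) := c :* m :* (h :* t)) refl (+ 2) (+ m) (+ c) (+ h) ⟩
      + c ℤ.* + m ℤ.* (+ h ℤ.* + 2)
        ≡⟨ cong₂ ℤ._*_ (trans (sym (ℤ.pos-* c m)) (cong +_ (sym p+1≡cm))) (sym (ℤ.pos-* h 2)) ⟩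
      (+ p ℤ.+ + 1) ℤ.* + (h ℕ.* 2)
        ≡⟨ solve 1 (λ x → (con ℤ.1ℤ :+ x :+ con ℤ.1ℤ) :* x := (con ℤ.1ℤ :+ x) :* (con ℤ.1ℤ :+ x) :- con ℤ.1ℤ) refl (+ (h ℕ.* 2)) ⟩
      + p ℤ.* + p ℤ.- + 1 ∎)
    scale : ∃[ t ] (+ 2 ℤ.* + m) ℤ.* t ≡ + p ℤ.* + p ℤ.- + 1 →
            ∃[ e ] (+ 2 ℤ.* + m) ℤ.* e ≡ d ℤ.* (+ 1 ℤ.- + p ℤ.* + p)
    scale (t , 2mt≡p²-1) = ℤ.- (d ℤ.* t) , (begin
      (+ 2 ℤ.* + m) ℤ.* ℤ.- (d ℤ.* t)          ≡⟨ solve 3 (λ x d t → x :* :- (d :* t) := :- d :* (x :* t)) refl (+ 2 ℤ.* + m) d t ⟩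
      ℤ.- d ℤ.* ((+ 2 ℤ.* + m) ℤ.* t)          ≡⟨ cong (λ x → ℤ.- d ℤ.* x) 2mt≡p²-1 ⟩
      ℤ.- d ℤ.* (+ p ℤ.* + p ℤ.- + 1)          ≡⟨ solve 2 (λ d x → :- d :* (x :- con ℤ.1ℤ) := d :* (con ℤ.1ℤ :- x)) refl d (+ p ℤ.* + p) ⟩
      d ℤ.* (+ 1 ℤ.- + p ℤ.* + p)              ∎)

-- Powers of a root of unity of prime order

module RootOfUnityPowers {c ℓ} (K : CommutativeRing c ℓ) where
  open CommutativeRing K
  open Exp semiring using (_^_; ^-homo-*; ^-assocʳ; ^-congʳ; ^-congˡ)
  open Divisibility *-commutativeSemigroup
    using (_∣_; _,_; ∣ʳ-trans; ∣-respʳ-≈; ∣-respˡ-≈)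
  open IntegerCoefficients K
  open QSeries K
  open PowerSums K using (1-x∣1-xⁿ; -1²ⁿ≈1)
  open SetoidReasoning setoid

  -- Inserting `(-1)²ᵇ = 1` turns the exponent `a` into `(a + b) + b`, where `a + b` is even.
  -1ᵃ≈-1ᵇ : ∀ a b h → a ℕ.+ b ≡ h ℕ.* 2 → (- 1#) ^ a ≈ (- 1#) ^ b
  -1ᵃ≈-1ᵇ a b h a+b≡2h = begin
    (- 1#) ^ a                                ≈⟨ *-identityʳ _ ⟨
    (- 1#) ^ a * 1#                           ≈⟨ *-congˡ (-1²ⁿ≈1 b) ⟨
    (- 1#) ^ a * (- 1#) ^ (b ℕ.* 2)           ≈⟨ ^-homo-* (- 1#) a (b ℕ.* 2) ⟨
    (- 1#) ^ (a ℕ.+ b ℕ.* 2)                  ≡⟨ ≡.cong ((- 1#) ^_) exponent ⟩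
    (- 1#) ^ (h ℕ.* 2 ℕ.+ b)                  ≈⟨ ^-homo-* (- 1#) (h ℕ.* 2) b ⟩
    (- 1#) ^ (h ℕ.* 2) * (- 1#) ^ b           ≈⟨ *-congʳ (-1²ⁿ≈1 h) ⟩
    1# * (- 1#) ^ b                           ≈⟨ *-identityˡ _ ⟩
    (- 1#) ^ b                                ∎
    where
    exponent : a ℕ.+ b ℕ.* 2 ≡ h ℕ.* 2 ℕ.+ b
    exponent = ≡.trans (≡.cong (a ℕ.+_) (≡.trans (ℕ.*-comm b 2) (≡.cong (b ℕ.+_) (ℕ.+-identityʳ b))))
                       (≡.trans (≡.sym (ℕ.+-assoc a b b)) (≡.cong (ℕ._+ b) a+b≡2h))

  module PrimeOrder {p} (p-prime : Prime p) (q : Carrier) (qᵖ≈1 : q ^ p ≈ 1#) (1-q-unit : 1# - q ∣ 1#) where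

    ^-periodic : ∀ i k → q ^ (i ℕ.+ k ℕ.* p) ≈ q ^ i
    ^-periodic i zero    = ^-congʳ q (ℕ.+-identityʳ i)
    ^-periodic i (suc k) = begin
      q ^ (i ℕ.+ (p ℕ.+ k ℕ.* p))     ≡⟨ ≡.cong (q ^_) (≡.trans (≡.cong (i ℕ.+_) (ℕ.+-comm p _)) (≡.sym (ℕ.+-assoc i _ p))) ⟩
      q ^ (i ℕ.+ k ℕ.* p ℕ.+ p)       ≈⟨ ^-homo-* q (i ℕ.+ k ℕ.* p) p ⟩
      q ^ (i ℕ.+ k ℕ.* p) * q ^ p     ≈⟨ *-cong (^-periodic i k) qᵖ≈1 ⟩
      q ^ i * 1#                      ≈⟨ *-identityʳ _ ⟩
      q ^ i                           ∎

    ^-mod : ∀ i j → + p ℤ.∣ + i ℤ.- + j → q ^ i ≈ q ^ j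
    ^-mod i j p∣i-j with congruent⇒offset i j p∣i-j
    ... | inj₁ (k , ≡.refl) = ^-periodic j k
    ... | inj₂ (k , ≡.refl) = sym (^-periodic i k)

    infix 8 q⁻_
    -- The inverse of `q ^ n`, realised as a natural power: `n (p - 1) ≡ -n` modulo `p`.
    q⁻_ : ℕ → Carrier
    q⁻ n = q ^ (n ℕ.* ℕ.pred p)

    q⁻-inverse : ∀ n → q⁻ n * q ^ n ≈ 1#
    q⁻-inverse n = begin
      q⁻ n * q ^ n                     ≈⟨ ^-homo-* q (n ℕ.* ℕ.pred p) n ⟨
      q ^ (n ℕ.* ℕ.pred p ℕ.+ n)       ≡⟨ ≡.cong (q ^_) exponent ⟩
      q ^ (n ℕ.* p)                    ≈⟨ ^-periodic 0 n ⟩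
      1#                               ∎
      where
      exponent : n ℕ.* ℕ.pred p ℕ.+ n ≡ n ℕ.* p
      exponent = ≡.trans (ℕ.+-comm _ n) (≡.trans (≡.sym (ℕ.*-suc n (ℕ.pred p)))
                   (≡.cong (n ℕ.*_) (ℕ.suc-pred p {{prime⇒nonZero p-prime}})))

    qⁿ-unit : ∀ n → q ^ n ∣ 1#
    qⁿ-unit n = q⁻ n , q⁻-inverse n

    q⁻-unique : ∀ {x y} n → x * q ^ n ≈ y → x ≈ y * q⁻ n
    q⁻-unique {x} {y} n xqⁿ≈y = unit-cancelʳ (qⁿ-unit n) (begin
      x * q ^ n              ≈⟨ xqⁿ≈y ⟩
      y                      ≈⟨ *-identityʳ y ⟨
      y * 1#                 ≈⟨ *-congˡ (q⁻-inverse n) ⟨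
      y * (q⁻ n * q ^ n)     ≈⟨ *-assoc _ _ _ ⟨
      y * q⁻ n * q ^ n       ∎)

    q⁻-congruent : ∀ i n → + p ℤ.∣ + i ℤ.+ + n → q ^ i ≈ q⁻ n
    q⁻-congruent i n p∣i+n = trans (q⁻-unique n (begin
      q ^ i * q ^ n        ≈⟨ ^-homo-* q i n ⟨
      q ^ (i ℕ.+ n)        ≈⟨ ^-mod (i ℕ.+ n) 0 (≡.subst (+ p ℤ.∣_) (≡.sym (ℤ.+-identityʳ (+ i ℤ.+ + n))) p∣i+n) ⟩
      1#                   ∎)) (*-identityˡ _)

    -- The counterpart of `q⁻-congruent` for the exponent `-i`: there the power of `q` stands in the
    -- denominator, so the value is tested by multiplying with it.
    q⁻-cancel : ∀ i n → + p ℤ.∣ ℤ.- (+ i) ℤ.+ + n → q⁻ n * q ^ i ≈ 1#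
    q⁻-cancel i n p∣n-i = trans (*-congˡ (sym (^-mod n i (≡.subst (+ p ℤ.∣_) (ℤ.+-comm (ℤ.- (+ i)) (+ n)) p∣n-i)))) (q⁻-inverse n)

    1-qⁿ-unit : ∀ n → p ∤ n → 1# - q ^ n ∣ 1#
    1-qⁿ-unit n p∤n = ∣ʳ-trans (∣-respʳ-≈ (+-congˡ (-‿cong qⁿˣ≈q)) (1-x∣1-xⁿ (q ^ n) x)) 1-q-unit
      where
      inverse = linear-congruence p-prime p∤n (+ 1)
      x = proj₁ inverse
      qⁿˣ≈q : (q ^ n) ^ x ≈ q
      qⁿˣ≈q = begin
        (q ^ n) ^ x       ≈⟨ ^-assocʳ q n x ⟩
        q ^ (n ℕ.* x)     ≈⟨ ^-mod (n ℕ.* x) 1 (≡.subst (λ k → + p ℤ.∣ k ℤ.- + 1) (≡.sym (ℤ.pos-* n x)) (proj₂ (proj₂ inverse))) ⟩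
        q * 1#            ≈⟨ *-identityʳ q ⟩
        q                 ∎

    module Base {m Q} (p∤m : p ∤ m) (Q≈qᵐ : Q ≈ q ^ m) where

      Qʲ≈qᵐʲ : ∀ j → Q ^ j ≈ q ^ (m ℕ.* j)
      Qʲ≈qᵐʲ j = trans (^-congˡ j Q≈qᵐ) (^-assocʳ q m j)

      1-Qʲ-unit : ∀ j → 0 < j → j < p → 1# - Q ^ j ∣ 1#
      1-Qʲ-unit (suc j) _ j<p = ∣-respˡ-≈ (+-congˡ (-‿cong (sym (Qʲ≈qᵐʲ (suc j)))))
        (1-qⁿ-unit (m ℕ.* suc j) λ p∣mj → [ p∤m , ℕ.>⇒∤ j<p ]′ (euclidsLemma m (suc j) p-prime p∣mj))

      open RootOfUnity Q p 1-Qʲ-unit public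

      module _ {r a b α β} (r≤m : r ≤ m) (1+a+b≡p : suc (a ℕ.+ b) ≡ p)
               (p∣ma+r : + p ℤ.∣ + m ℤ.* + a ℤ.+ + r)
               (α≈qʳ : α ≈ q ^ r) (β≈qᵐ⁻ʳ : β ≈ q ^ (m ℕ.∸ r)) where

        private
          module ℤS = IntegerCoefficients ℤ.+-*-commutativeRing
          r+ma : + m ℤ.* + a ℤ.+ + r ≡ + (r ℕ.+ m ℕ.* a) ℤ.- + 0
          r+ma = ≡.trans (ℤS.solve 2 (λ x r → x ℤS.:+ r ℤS.:= r ℤS.:+ x ℤS.:- ℤS.con ℤ.0ℤ) ≡.refl (+ m ℤ.* + a) (+ r))
                         (≡.cong (λ x → + r ℤ.+ x ℤ.- + 0) (≡.sym (ℤ.pos-* m a)))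
          m-r-m[1+a] : ℤ.- (+ m ℤ.* + a ℤ.+ + r) ≡ + (m ℕ.∸ r) ℤ.- + (m ℕ.* suc a)
          m-r-m[1+a] = ≡.trans
            (ℤS.solve 3 (λ m a r → ℤS.:- (m ℤS.:* a ℤS.:+ r) ℤS.:= m ℤS.:- r ℤS.:- m ℤS.:* (ℤS.con ℤ.1ℤ ℤS.:+ a)) ≡.refl (+ m) (+ a) (+ r))
            (≡.sym (≡.cong₂ ℤ._-_ (pos-∸ r≤m) (ℤ.pos-* m (suc a))))

        αβ≈Q : α * β ≈ Q
        αβ≈Q = begin
          α * β                     ≈⟨ *-cong α≈qʳ β≈qᵐ⁻ʳ ⟩
          q ^ r * q ^ (m ℕ.∸ r)     ≈⟨ ^-homo-* q r (m ℕ.∸ r) ⟨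
          q ^ (r ℕ.+ (m ℕ.∸ r))     ≡⟨ ≡.cong (q ^_) (ℕ.m+[n∸m]≡n r≤m) ⟩
          q ^ m                     ≈⟨ Q≈qᵐ ⟨
          Q                         ∎

        αQᵃ≈1 : α * Q ^ a ≈ 1#
        αQᵃ≈1 = begin
          α * Q ^ a                 ≈⟨ *-cong α≈qʳ (Qʲ≈qᵐʲ a) ⟩
          q ^ r * q ^ (m ℕ.* a)     ≈⟨ ^-homo-* q r (m ℕ.* a) ⟨
          q ^ (r ℕ.+ m ℕ.* a)       ≈⟨ ^-mod (r ℕ.+ m ℕ.* a) 0 (≡.subst (+ p ℤ.∣_) r+ma p∣ma+r) ⟩
          1#                        ∎

        -- Since `m a ≡ -r`, the exponents `m - r` and `m (a + 1)` agree modulo `p`.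
        β≈Qᵃ⁺¹ : β ≈ Q ^ suc a
        β≈Qᵃ⁺¹ = begin
          β                         ≈⟨ β≈qᵐ⁻ʳ ⟩
          q ^ (m ℕ.∸ r)             ≈⟨ ^-mod (m ℕ.∸ r) (m ℕ.* suc a) (≡.subst (+ p ℤ.∣_) m-r-m[1+a] (ℤ.∣m⇒∣-m {m = + m ℤ.* + a ℤ.+ + r} p∣ma+r)) ⟩
          q ^ (m ℕ.* suc a)         ≈⟨ Qʲ≈qᵐʲ (suc a) ⟨
          Q ^ suc a                 ∎

        βQᵇ≈1 : β * Q ^ b ≈ 1#
        βQᵇ≈1 = begin
          β * Q ^ b                 ≈⟨ *-congʳ β≈Qᵃ⁺¹ ⟩
          Q ^ suc a * Q ^ b         ≈⟨ ^-homo-* Q (suc a) b ⟨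
          Q ^ (suc a ℕ.+ b)         ≡⟨ ≡.cong (Q ^_) 1+a+b≡p ⟩
          Q ^ p                     ≈⟨ Qʲ≈qᵐʲ p ⟩
          q ^ (m ℕ.* p)             ≈⟨ ^-periodic 0 m ⟩
          1#                        ∎

        ratio-convolution : ∀ s N → s ≤ b → N ℕ.+ s ≡ p →
          ∑< N (λ k → ratio α k * ratio β (k ℕ.+ s)) * q ^ (m ℕ.* triangular b) ≈ (- 1#) ^ b
        ratio-convolution s N s≤b N+s≡p = trans (*-congˡ (sym (Qʲ≈qᵐʲ (triangular b))))
          (Convolution.convolution-value (ratio-isRatio α) (ratio-isRatio β) αβ≈Q
            1+a+b≡p αQᵃ≈1 β≈Qᵃ⁺¹ βQᵇ≈1 s N s≤b N+s≡p)

-- The ring ℚ[q]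

open ≡ using (refl; sym; trans; cong; cong₂; subst)
open IntegerCoefficients ℚ.+-*-commutativeRing using (solve; _:+_; _:*_; _:=_)

-- The mirror image of `coeff-*`. Commutativity follows by comparing the recursions in the two
-- arguments.
coeff-*-∷ʳ : ∀ f b bs i →
  coeff (f *ᵖ (b ∷ bs)) i ≡ b ℚ.* coeff f i ℚ.+ coeff (0ℚ ∷ (f *ᵖ bs)) i
coeff-*-∷ʳ []       b bs zero    = sym (trans (ℚ.+-identityʳ _) (ℚ.*-zeroʳ b))
coeff-*-∷ʳ []       b bs (suc i) = sym (trans (ℚ.+-identityʳ _) (ℚ.*-zeroʳ b))
coeff-*-∷ʳ (a ∷ as) b bs zero    =
  trans (coeff-* a as (b ∷ bs) 0) (cong (ℚ._+ 0ℚ) (ℚ.*-comm a b))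
coeff-*-∷ʳ (a ∷ as) b bs (suc i) = begin
  coeff ((a ∷ as) *ᵖ (b ∷ bs)) (suc i)
    ≡⟨ coeff-* a as (b ∷ bs) (suc i) ⟩
  a ℚ.* coeff bs i ℚ.+ coeff (as *ᵖ (b ∷ bs)) i
    ≡⟨ cong (a ℚ.* coeff bs i ℚ.+_) (coeff-*-∷ʳ as b bs i) ⟩
  a ℚ.* coeff bs i ℚ.+ (b ℚ.* coeff as i ℚ.+ coeff (0ℚ ∷ (as *ᵖ bs)) i)
    ≡⟨ solve 3 (λ x y z → x :+ (y :+ z) := y :+ (x :+ z)) refl (a ℚ.* coeff bs i) (b ℚ.* coeff as i) _ ⟩
  b ℚ.* coeff as i ℚ.+ (a ℚ.* coeff bs i ℚ.+ coeff (0ℚ ∷ (as *ᵖ bs)) i)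
    ≡⟨ cong (b ℚ.* coeff as i ℚ.+_) (coeff-* a as bs i) ⟨
  b ℚ.* coeff as i ℚ.+ coeff ((a ∷ as) *ᵖ bs) i ∎
  where open ≡.≡-Reasoning

∷-cong : ∀ a {f g} → f ≈ᵖ g → a ∷ f ≈ᵖ a ∷ g
∷-cong a f≈g zero    = refl
∷-cong a f≈g (suc i) = f≈g i

+ᵖ-cong : ∀ f f′ g g′ → f ≈ᵖ f′ → g ≈ᵖ g′ → f +ᵖ g ≈ᵖ f′ +ᵖ g′
+ᵖ-cong f f′ g g′ f≈f′ g≈g′ i =
  trans (coeff-+ f g i) (trans (cong₂ ℚ._+_ (f≈f′ i) (g≈g′ i)) (sym (coeff-+ f′ g′ i)))

+ᵖ-comm : ∀ f g → f +ᵖ g ≈ᵖ g +ᵖ f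
+ᵖ-comm f g i = trans (coeff-+ f g i) (trans (ℚ.+-comm (coeff f i) (coeff g i)) (sym (coeff-+ g f i)))

+ᵖ-assoc : ∀ f g h → (f +ᵖ g) +ᵖ h ≈ᵖ f +ᵖ (g +ᵖ h)
+ᵖ-assoc f g h i = begin
  coeff (f +ᵖ g +ᵖ h) i                            ≡⟨ coeff-+ (f +ᵖ g) h i ⟩
  coeff (f +ᵖ g) i ℚ.+ coeff h i                   ≡⟨ cong (ℚ._+ coeff h i) (coeff-+ f g i) ⟩
  coeff f i ℚ.+ coeff g i ℚ.+ coeff h i            ≡⟨ ℚ.+-assoc (coeff f i) (coeff g i) (coeff h i) ⟩
  coeff f i ℚ.+ (coeff g i ℚ.+ coeff h i)          ≡⟨ cong (coeff f i ℚ.+_) (coeff-+ g h i) ⟨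
  coeff f i ℚ.+ coeff (g +ᵖ h) i                   ≡⟨ coeff-+ f (g +ᵖ h) i ⟨
  coeff (f +ᵖ (g +ᵖ h)) i                          ∎
  where open ≡.≡-Reasoning

+ᵖ-inverseʳ : ∀ f → f -ᵖ f ≈ᵖ 0ᵖ
+ᵖ-inverseʳ f i =
  trans (coeff-+ f (-ᵖ f) i) (trans (cong (coeff f i ℚ.+_) (coeff-neg f i)) (ℚ.+-inverseʳ (coeff f i)))

-ᵖ-cong : ∀ f g → f ≈ᵖ g → -ᵖ f ≈ᵖ -ᵖ g
-ᵖ-cong f g f≈g i = trans (coeff-neg f i) (trans (cong ℚ.-_ (f≈g i)) (sym (coeff-neg g i)))

*ᵖ-comm : ∀ f g → f *ᵖ g ≈ᵖ g *ᵖ f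
*ᵖ-comm []       []       i = refl
*ᵖ-comm []       (b ∷ bs) i = sym (begin
  coeff ((b ∷ bs) *ᵖ []) i                  ≡⟨ coeff-* b bs [] i ⟩
  b ℚ.* 0ℚ ℚ.+ coeff (0ℚ ∷ (bs *ᵖ [])) i    ≡⟨ cong₂ ℚ._+_ (ℚ.*-zeroʳ b) (∷-≈0 refl (λ j → sym (*ᵖ-comm [] bs j)) i) ⟩
  0ℚ                                        ∎)
  where open ≡.≡-Reasoning
*ᵖ-comm (a ∷ as) g        i = begin
  coeff ((a ∷ as) *ᵖ g) i                             ≡⟨ coeff-* a as g i ⟩
  a ℚ.* coeff g i ℚ.+ coeff (0ℚ ∷ (as *ᵖ g)) i        ≡⟨ cong (a ℚ.* coeff g i ℚ.+_) (∷-cong 0ℚ {as *ᵖ g} {g *ᵖ as} (*ᵖ-comm as g) i) ⟩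
  a ℚ.* coeff g i ℚ.+ coeff (0ℚ ∷ (g *ᵖ as)) i        ≡⟨ coeff-*-∷ʳ g a as i ⟨
  coeff (g *ᵖ (a ∷ as)) i                             ∎
  where open ≡.≡-Reasoning

*ᵖ-congˡ : ∀ f g g′ → g ≈ᵖ g′ → f *ᵖ g ≈ᵖ f *ᵖ g′
*ᵖ-congˡ []       g g′ g≈g′ i = refl
*ᵖ-congˡ (a ∷ as) g g′ g≈g′ i = begin
  coeff ((a ∷ as) *ᵖ g) i                             ≡⟨ coeff-* a as g i ⟩
  a ℚ.* coeff g i ℚ.+ coeff (0ℚ ∷ (as *ᵖ g)) i        ≡⟨ cong₂ (λ x y → a ℚ.* x ℚ.+ y) (g≈g′ i) (∷-cong 0ℚ {as *ᵖ g} {as *ᵖ g′} (*ᵖ-congˡ as g g′ g≈g′) i) ⟩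
  a ℚ.* coeff g′ i ℚ.+ coeff (0ℚ ∷ (as *ᵖ g′)) i      ≡⟨ coeff-* a as g′ i ⟨
  coeff ((a ∷ as) *ᵖ g′) i                            ∎
  where open ≡.≡-Reasoning

-- Lists related by `_≈ᵖ_` may differ in length, so recursion along the first factor gives no
-- congruence in that factor; commutativity moves it to the second place.
*ᵖ-cong : ∀ f f′ g g′ → f ≈ᵖ f′ → g ≈ᵖ g′ → f *ᵖ g ≈ᵖ f′ *ᵖ g′
*ᵖ-cong f f′ g g′ f≈f′ g≈g′ i = begin
  coeff (f *ᵖ g) i      ≡⟨ *ᵖ-congˡ f g g′ g≈g′ i ⟩
  coeff (f *ᵖ g′) i     ≡⟨ *ᵖ-comm f g′ i ⟩
  coeff (g′ *ᵖ f) i     ≡⟨ *ᵖ-congˡ g′ f f′ f≈f′ i ⟩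
  coeff (g′ *ᵖ f′) i    ≡⟨ *ᵖ-comm g′ f′ i ⟩
  coeff (f′ *ᵖ g′) i    ∎
  where open ≡.≡-Reasoning

∷-+ : ∀ f g → 0ℚ ∷ (f +ᵖ g) ≈ᵖ (0ℚ ∷ f) +ᵖ (0ℚ ∷ g)
∷-+ f g zero    = refl
∷-+ f g (suc i) = refl

*ᵖ-distribˡ : ∀ f g h → f *ᵖ (g +ᵖ h) ≈ᵖ f *ᵖ g +ᵖ f *ᵖ h
*ᵖ-distribˡ []       g h i = refl
*ᵖ-distribˡ (a ∷ as) g h i = begin
  coeff ((a ∷ as) *ᵖ (g +ᵖ h)) i
    ≡⟨ coeff-* a as (g +ᵖ h) i ⟩
  a ℚ.* coeff (g +ᵖ h) i ℚ.+ coeff (0ℚ ∷ (as *ᵖ (g +ᵖ h))) i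
    ≡⟨ cong₂ (λ x y → a ℚ.* x ℚ.+ y) (coeff-+ g h i) tail ⟩
  a ℚ.* (coeff g i ℚ.+ coeff h i) ℚ.+ (coeff (0ℚ ∷ (as *ᵖ g)) i ℚ.+ coeff (0ℚ ∷ (as *ᵖ h)) i)
    ≡⟨ solve 5 (λ a x y z w → a :* (x :+ y) :+ (z :+ w) := a :* x :+ z :+ (a :* y :+ w)) refl a (coeff g i) (coeff h i) _ _ ⟩
  a ℚ.* coeff g i ℚ.+ coeff (0ℚ ∷ (as *ᵖ g)) i ℚ.+ (a ℚ.* coeff h i ℚ.+ coeff (0ℚ ∷ (as *ᵖ h)) i)
    ≡⟨ cong₂ ℚ._+_ (coeff-* a as g i) (coeff-* a as h i) ⟨
  coeff ((a ∷ as) *ᵖ g) i ℚ.+ coeff ((a ∷ as) *ᵖ h) i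
    ≡⟨ coeff-+ ((a ∷ as) *ᵖ g) ((a ∷ as) *ᵖ h) i ⟨
  coeff ((a ∷ as) *ᵖ g +ᵖ (a ∷ as) *ᵖ h) i ∎
  where
  open ≡.≡-Reasoning
  tail : coeff (0ℚ ∷ (as *ᵖ (g +ᵖ h))) i ≡ coeff (0ℚ ∷ (as *ᵖ g)) i ℚ.+ coeff (0ℚ ∷ (as *ᵖ h)) i
  tail = trans (∷-cong 0ℚ {as *ᵖ (g +ᵖ h)} {as *ᵖ g +ᵖ as *ᵖ h} (*ᵖ-distribˡ as g h) i)
               (trans (∷-+ (as *ᵖ g) (as *ᵖ h) i) (coeff-+ (0ℚ ∷ (as *ᵖ g)) (0ℚ ∷ (as *ᵖ h)) i))

*ᵖ-distribʳ : ∀ f g h → (g +ᵖ h) *ᵖ f ≈ᵖ g *ᵖ f +ᵖ h *ᵖ f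
*ᵖ-distribʳ f g h i = begin
  coeff ((g +ᵖ h) *ᵖ f) i         ≡⟨ *ᵖ-comm (g +ᵖ h) f i ⟩
  coeff (f *ᵖ (g +ᵖ h)) i         ≡⟨ *ᵖ-distribˡ f g h i ⟩
  coeff (f *ᵖ g +ᵖ f *ᵖ h) i      ≡⟨ +ᵖ-cong (f *ᵖ g) (g *ᵖ f) (f *ᵖ h) (h *ᵖ f) (*ᵖ-comm f g) (*ᵖ-comm f h) i ⟩
  coeff (g *ᵖ f +ᵖ h *ᵖ f) i      ∎
  where open ≡.≡-Reasoning

scale-* : ∀ a f g → map (a ℚ.*_) f *ᵖ g ≈ᵖ map (a ℚ.*_) (f *ᵖ g)
scale-* a []       g i = refl
scale-* a (b ∷ bs) g i = begin
  coeff (map (a ℚ.*_) (b ∷ bs) *ᵖ g) i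
    ≡⟨ coeff-* (a ℚ.* b) (map (a ℚ.*_) bs) g i ⟩
  a ℚ.* b ℚ.* coeff g i ℚ.+ coeff (0ℚ ∷ (map (a ℚ.*_) bs *ᵖ g)) i
    ≡⟨ cong (a ℚ.* b ℚ.* coeff g i ℚ.+_) (tail i) ⟩
  a ℚ.* b ℚ.* coeff g i ℚ.+ a ℚ.* coeff (0ℚ ∷ (bs *ᵖ g)) i
    ≡⟨ solve 4 (λ a b x y → a :* b :* x :+ a :* y := a :* (b :* x :+ y)) refl a b (coeff g i) _ ⟩
  a ℚ.* (b ℚ.* coeff g i ℚ.+ coeff (0ℚ ∷ (bs *ᵖ g)) i)
    ≡⟨ cong (a ℚ.*_) (coeff-* b bs g i) ⟨
  a ℚ.* coeff ((b ∷ bs) *ᵖ g) i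
    ≡⟨ coeff-scale a ((b ∷ bs) *ᵖ g) i ⟨
  coeff (map (a ℚ.*_) ((b ∷ bs) *ᵖ g)) i ∎
  where
  open ≡.≡-Reasoning
  tail : ∀ i → coeff (0ℚ ∷ (map (a ℚ.*_) bs *ᵖ g)) i ≡ a ℚ.* coeff (0ℚ ∷ (bs *ᵖ g)) i
  tail zero    = sym (ℚ.*-zeroʳ a)
  tail (suc i) = trans (scale-* a bs g i) (coeff-scale a (bs *ᵖ g) i)

*ᵖ-assoc : ∀ f g h → (f *ᵖ g) *ᵖ h ≈ᵖ f *ᵖ (g *ᵖ h)
*ᵖ-assoc []       g h i = refl
*ᵖ-assoc (a ∷ as) g h i = begin
  coeff ((map (a ℚ.*_) g +ᵖ (0ℚ ∷ (as *ᵖ g))) *ᵖ h) i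
    ≡⟨ *ᵖ-distribʳ h (map (a ℚ.*_) g) (0ℚ ∷ (as *ᵖ g)) i ⟩
  coeff (map (a ℚ.*_) g *ᵖ h +ᵖ (0ℚ ∷ (as *ᵖ g)) *ᵖ h) i
    ≡⟨ coeff-+ (map (a ℚ.*_) g *ᵖ h) ((0ℚ ∷ (as *ᵖ g)) *ᵖ h) i ⟩
  coeff (map (a ℚ.*_) g *ᵖ h) i ℚ.+ coeff ((0ℚ ∷ (as *ᵖ g)) *ᵖ h) i
    ≡⟨ cong₂ ℚ._+_ (trans (scale-* a g h i) (coeff-scale a (g *ᵖ h) i)) tail ⟩
  a ℚ.* coeff (g *ᵖ h) i ℚ.+ coeff (0ℚ ∷ (as *ᵖ (g *ᵖ h))) i
    ≡⟨ coeff-* a as (g *ᵖ h) i ⟨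
  coeff ((a ∷ as) *ᵖ (g *ᵖ h)) i ∎
  where
  open ≡.≡-Reasoning
  tail : coeff ((0ℚ ∷ (as *ᵖ g)) *ᵖ h) i ≡ coeff (0ℚ ∷ (as *ᵖ (g *ᵖ h))) i
  tail = begin
    coeff ((0ℚ ∷ (as *ᵖ g)) *ᵖ h) i
      ≡⟨ coeff-* 0ℚ (as *ᵖ g) h i ⟩
    0ℚ ℚ.* coeff h i ℚ.+ coeff (0ℚ ∷ (as *ᵖ g *ᵖ h)) i
      ≡⟨ trans (cong (ℚ._+ coeff (0ℚ ∷ (as *ᵖ g *ᵖ h)) i) (ℚ.*-zeroˡ (coeff h i))) (ℚ.+-identityˡ _) ⟩
    coeff (0ℚ ∷ (as *ᵖ g *ᵖ h)) i
      ≡⟨ ∷-cong 0ℚ {as *ᵖ g *ᵖ h} {as *ᵖ (g *ᵖ h)} (*ᵖ-assoc as g h) i ⟩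
    coeff (0ℚ ∷ (as *ᵖ (g *ᵖ h))) i ∎

constant-* : ∀ c f i → coeff ((c ∷ []) *ᵖ f) i ≡ c ℚ.* coeff f i
constant-* c f i = begin
  coeff ((c ∷ []) *ᵖ f) i                        ≡⟨ coeff-* c [] f i ⟩
  c ℚ.* coeff f i ℚ.+ coeff (0ℚ ∷ []) i          ≡⟨ cong (c ℚ.* coeff f i ℚ.+_) (∷-≈0 {0ℚ} {[]} refl (λ _ → refl) i) ⟩
  c ℚ.* coeff f i ℚ.+ 0ℚ                         ≡⟨ ℚ.+-identityʳ _ ⟩
  c ℚ.* coeff f i                                ∎
  where open ≡.≡-Reasoning

*ᵖ-identityˡ : ∀ f → 1ᵖ *ᵖ f ≈ᵖ f
*ᵖ-identityˡ f i = trans (constant-* 1ℚ f i) (ℚ.*-identityˡ _)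

polyRing : CommutativeRing 0ℓ 0ℓ
polyRing = record
  { Carrier = Poly
  ; _≈_ = _≈ᵖ_
  ; _+_ = _+ᵖ_
  ; _*_ = _*ᵖ_
  ; -_  = -ᵖ_
  ; 0#  = 0ᵖ
  ; 1#  = 1ᵖ
  ; isCommutativeRing = record
    { isRing = record
      { +-isAbelianGroup = record
        { isGroup = record
          { isMonoid = record
            { isSemigroup = record
              { isMagma = record
                { isEquivalence = record
                  { refl  = λ _ → refl
                  ; sym   = λ f≈g i → sym (f≈g i)
                  ; trans = λ f≈g g≈h i → trans (f≈g i) (g≈h i)
                  }
                ; ∙-cong = λ {f} {f′} {g} {g′} → +ᵖ-cong f f′ g g′
                }
              ; assoc = +ᵖ-assoc
              }
            ; identity = (λ f i → refl) , (λ f → +ᵖ-comm f [])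
            }
          ; inverse = (λ f i → trans (+ᵖ-comm (-ᵖ f) f i) (+ᵖ-inverseʳ f i)) , +ᵖ-inverseʳ
          ; ⁻¹-cong = λ {f} {g} → -ᵖ-cong f g
          }
        ; comm = +ᵖ-comm
        }
      ; *-cong = λ {f} {f′} {g} {g′} → *ᵖ-cong f f′ g g′
      ; *-assoc = *ᵖ-assoc
      ; *-identity = *ᵖ-identityˡ , (λ f i → trans (*ᵖ-comm f 1ᵖ i) (*ᵖ-identityˡ f i))
      ; distrib = *ᵖ-distribˡ , *ᵖ-distribʳ
      }
    ; *-comm = *ᵖ-comm
    }
  }

open BezoutTheory polyRing using (Bezout; bezout-zeroˡ; bezout-sym; bezout-sub; Reduction; module Reduction; reduction)

-- The Euclidean algorithm in ℚ[q]

monomial : ℚ → ℕ → Poly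
monomial c zero    = c ∷ []
monomial c (suc j) = 0ℚ ∷ monomial c j

coeff-monomial-* : ∀ c j f i → coeff (monomial c j *ᵖ f) (j ℕ.+ i) ≡ c ℚ.* coeff f i
coeff-monomial-* c zero    f i = constant-* c f i
coeff-monomial-* c (suc j) f i = begin
  coeff ((0ℚ ∷ monomial c j) *ᵖ f) (suc j ℕ.+ i)
    ≡⟨ coeff-* 0ℚ (monomial c j) f (suc j ℕ.+ i) ⟩
  0ℚ ℚ.* coeff f (suc j ℕ.+ i) ℚ.+ coeff (monomial c j *ᵖ f) (j ℕ.+ i)
    ≡⟨ cong₂ ℚ._+_ (ℚ.*-zeroˡ (coeff f (suc j ℕ.+ i))) (coeff-monomial-* c j f i) ⟩
  0ℚ ℚ.+ c ℚ.* coeff f i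
    ≡⟨ ℚ.+-identityˡ _ ⟩
  c ℚ.* coeff f i ∎
  where open ≡.≡-Reasoning

-- An upper bound rather than the degree itself, since lists may end in zeros. The bound 0
-- characterises the zero polynomial.
DegreeBelow : ℕ → Poly → Set
DegreeBelow n f = ∀ i → n ≤ i → coeff f i ≡ 0ℚ

degreeBelow-length : ∀ f → DegreeBelow (length f) f
degreeBelow-length []      i       _         = refl
degreeBelow-length (a ∷ f) (suc i) (s≤s n≤i) = degreeBelow-length f i n≤i

degreeBelow-pred : ∀ {n} f → DegreeBelow (suc n) f → coeff f n ≡ 0ℚ → DegreeBelow n f
degreeBelow-pred f f<1+n fₙ≡0 i n≤i with ℕ.m≤n⇒m<n∨m≡n n≤i
... | inj₁ n<i  = f<1+n i n<i
... | inj₂ refl = fₙ≡0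

-- One step of long division, with `k = (gₗ / fₙ) qˡ⁻ⁿ`: at index `l` the leading terms cancel, and
-- above it both polynomials vanish.
cancel-leading : ∀ {n l} f g → n ≤ l → DegreeBelow (suc n) f → DegreeBelow (suc l) g →
                 ¬ coeff f n ≡ 0ℚ → ∃[ k ] DegreeBelow l (g -ᵖ k *ᵖ f)
cancel-leading {n} {l} f g n≤l f<1+n g<1+l fₙ≢0 = k , λ i l≤i → begin
  coeff (g -ᵖ k *ᵖ f) i                            ≡⟨ coeff-+ g (-ᵖ (k *ᵖ f)) i ⟩
  coeff g i ℚ.+ coeff (-ᵖ (k *ᵖ f)) i              ≡⟨ cong (coeff g i ℚ.+_) (coeff-neg (k *ᵖ f) i) ⟩
  coeff g i ℚ.- coeff (k *ᵖ f) i                   ≡⟨ cong (λ x → coeff g i ℚ.- x) (coeff-k*f i l≤i) ⟩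
  coeff g i ℚ.- c ℚ.* coeff f (i ℕ.∸ j)            ≡⟨ vanish i (ℕ.m≤n⇒m<n∨m≡n l≤i) ⟩
  0ℚ                                               ∎
  where
  open ≡.≡-Reasoning
  instance
    fₙ-nonZero : ℚ.NonZero (coeff f n)
    fₙ-nonZero = ℚ.≢-nonZero fₙ≢0
  j = l ℕ.∸ n
  c = coeff g l ℚ.* ℚ.1/ coeff f n
  k = monomial c j
  l∸j≡n : l ℕ.∸ j ≡ n
  l∸j≡n = ℕ.m∸[m∸n]≡n n≤l
  coeff-k*f : ∀ i → l ≤ i → coeff (k *ᵖ f) i ≡ c ℚ.* coeff f (i ℕ.∸ j)
  coeff-k*f i l≤i = subst (λ h → coeff (k *ᵖ f) h ≡ c ℚ.* coeff f (i ℕ.∸ j))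
    (ℕ.m+[n∸m]≡n (ℕ.≤-trans (ℕ.m∸n≤m l n) l≤i)) (coeff-monomial-* c j f (i ℕ.∸ j))
  vanish : ∀ i → l < i ⊎ l ≡ i → coeff g i ℚ.- c ℚ.* coeff f (i ℕ.∸ j) ≡ 0ℚ
  vanish i (inj₁ l<i) = begin
    coeff g i ℚ.- c ℚ.* coeff f (i ℕ.∸ j)
      ≡⟨ cong₂ (λ x y → x ℚ.- c ℚ.* y) (g<1+l i l<i) (f<1+n (i ℕ.∸ j) (subst (_< i ℕ.∸ j) l∸j≡n (ℕ.∸-monoˡ-< l<i (ℕ.m∸n≤m l n)))) ⟩
    0ℚ ℚ.- c ℚ.* 0ℚ
      ≡⟨ cong (λ x → 0ℚ ℚ.- x) (ℚ.*-zeroʳ c) ⟩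
    0ℚ ∎
  vanish i (inj₂ refl) = begin
    coeff g l ℚ.- c ℚ.* coeff f (l ℕ.∸ j)
      ≡⟨ cong (λ h → coeff g l ℚ.- c ℚ.* coeff f h) l∸j≡n ⟩
    coeff g l ℚ.- c ℚ.* coeff f n
      ≡⟨ cong (λ x → coeff g l ℚ.- x) (trans (ℚ.*-assoc (coeff g l) _ _) (trans (cong (coeff g l ℚ.*_) (ℚ.*-inverseˡ (coeff f n))) (ℚ.*-identityʳ _))) ⟩
    coeff g l ℚ.- coeff g l
      ≡⟨ ℚ.+-inverseʳ (coeff g l) ⟩
    0ℚ ∎

-- Each step lowers one of the two degree bounds by one, either because the coefficient at the bound
-- is zero or by `cancel-leading`. The number `h` bounds their sum and makes the recursion
-- structural.
euclid-algorithm : ∀ h n l f g → n ℕ.+ l ≤ h → DegreeBelow n f → DegreeBelow l g → Bezout f g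
euclid-algorithm h       zero    l       f g _ f<n g<l = bezout-zeroˡ {f} g (λ i → f<n i z≤n)
euclid-algorithm h       (suc n) zero    f g _ f<n g<l = bezout-sym {g} {f} (bezout-zeroˡ {g} f (λ i → g<l i z≤n))
euclid-algorithm (suc h) (suc n) (suc l) f g (s≤s n+l≤h) f<n g<l with coeff f n ℚ.≟ 0ℚ | coeff g l ℚ.≟ 0ℚ
... | yes fₙ≡0 | _        = euclid-algorithm h n (suc l) f g n+l≤h (degreeBelow-pred f f<n fₙ≡0) g<l
... | no  _    | yes gₗ≡0 = euclid-algorithm h (suc n) l f g (subst (_≤ h) (ℕ.+-suc n l) n+l≤h) f<n (degreeBelow-pred g g<l gₗ≡0)
... | no fₙ≢0  | no gₗ≢0 with ℕ.≤-total n l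
...   | inj₁ n≤l with k , g′<l ← cancel-leading f g n≤l f<n g<l fₙ≢0 =
  bezout-sub {f} {g} k (euclid-algorithm h (suc n) l f (g -ᵖ k *ᵖ f) (subst (_≤ h) (ℕ.+-suc n l) n+l≤h) f<n g′<l)
...   | inj₂ l≤n with k , f′<n ← cancel-leading g f l≤n g<l f<n gₗ≢0 =
  bezout-sym {g} {f} (bezout-sub {g} {f} k (bezout-sym {f -ᵖ k *ᵖ g} {g}
    (euclid-algorithm h n (suc l) (f -ᵖ k *ᵖ g) g n+l≤h f′<n g<l)))

bezout : ∀ f g → Bezout f g
bezout f g = euclid-algorithm _ (length f) (length g) f g ℕ.≤-refl (degreeBelow-length f) (degreeBelow-length g)

lowest-terms : ∀ A → Reduction (num A) (den A)
lowest-terms A = reduction *ᵖ-zero-product (den≉0 A) (bezout (num A) (den A))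

-- Congruences in ℚ(q)

open import Data.Nat using (_+_; _*_; _∸_; _/_)
open import Data.Nat.Divisibility using (_∣_)

q-* : ∀ f → q *ᵖ f ≈ᵖ 0ℚ ∷ f
q-* f i = begin
  coeff (q *ᵖ f) i                                     ≡⟨ coeff-* 0ℚ 1ᵖ f i ⟩
  0ℚ ℚ.* coeff f i ℚ.+ coeff (0ℚ ∷ (1ᵖ *ᵖ f)) i        ≡⟨ cong₂ ℚ._+_ (ℚ.*-zeroˡ (coeff f i)) (∷-cong 0ℚ {1ᵖ *ᵖ f} {f} (*ᵖ-identityˡ f) i) ⟩
  0ℚ ℚ.+ coeff (0ℚ ∷ f) i                              ≡⟨ ℚ.+-identityˡ _ ⟩
  coeff (0ℚ ∷ f) i                                     ∎
  where open ≡.≡-Reasoning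

[suc]q : ∀ n → [ suc n ]q ≈ᵖ 1ᵖ +ᵖ q *ᵖ [ n ]q
[suc]q n i = trans (shift i) (+ᵖ-cong 1ᵖ 1ᵖ (0ℚ ∷ [ n ]q) (q *ᵖ [ n ]q) (λ _ → refl) (λ j → sym (q-* [ n ]q j)) i)
  where
  shift : ∀ i → coeff (1ℚ ∷ [ n ]q) i ≡ coeff (1ᵖ +ᵖ (0ℚ ∷ [ n ]q)) i
  shift zero    = refl
  shift (suc i) = refl

open Mult (CommutativeRing.semiring ℚ.+-*-commutativeRing) using () renaming (_×_ to _·_)

·1-nonNegative : ∀ n → ℚ.NonNegative (n · 1ℚ)
·1-nonNegative zero    = _
·1-nonNegative (suc n) = ℚ.nonNeg+nonNeg⇒nonNeg 1ℚ (n · 1ℚ) {{·1-nonNegative n}}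

-- Characteristic zero, obtained from the order of `ℚ`. It makes `p` invertible, and with it
-- `1 - q`.
·1-nonZero : ∀ n .{{_ : NonZero n}} → ℚ.NonZero (n · 1ℚ)
·1-nonZero (suc n) = ℚ.pos⇒nonZero (suc n · 1ℚ) {{ℚ.pos+nonNeg⇒pos 1ℚ (n · 1ℚ) {{·1-nonNegative n}}}}

module Modulo (M : Poly) where
  open Quotient polyRing M using (_~_; ≈⇒~; M~0; quotientRing) public
  open Evaluation polyRing M public
    using (Evaluates; evaluates; evaluates-+; evaluates-*; evaluates-resp; evaluates-element; difference∼0; reduced-den-coprime; reduced-num-divisible)
  private module K = CommutativeRing quotientRing
  open Exp K.semiring public using () renaming (_^_ to _^ᴷ_)
  open Mult K.semiring public using () renaming (_×_ to _·ᴷ_)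
  open Divisibility K.*-commutativeSemigroup public
    using () renaming (_∣_ to _∣ᴷ_; _,_ to _,ᴷ_)
  open QSeries quotientRing public using (pochhammer; ∑<)

  -- Not definitional: the library's power takes the ring, including its equality relation, as a parameter.
  ^ᵖ≡^ᴷ : ∀ f n → f ^ᵖ n ≡ f ^ᴷ n
  ^ᵖ≡^ᴷ f zero    = refl
  ^ᵖ≡^ᴷ f (suc n) = cong (f *ᵖ_) (^ᵖ≡^ᴷ f n)

  ⦅⦆≡pochhammer : ∀ a x n → ⦅ a ⨾ x ⦆ n ≡ pochhammer a x n
  ⦅⦆≡pochhammer a x zero    = refl
  ⦅⦆≡pochhammer a x (suc n) = cong₂ (λ f g → f *ᵖ (1ᵖ -ᵖ a *ᵖ g)) (⦅⦆≡pochhammer a x n) (^ᵖ≡^ᴷ x n)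

  ·1-constant : ∀ n → n ·ᴷ 1ᵖ ≈ᵖ (n · 1ℚ) ∷ []
  ·1-constant zero    zero    = refl
  ·1-constant zero    (suc i) = refl
  ·1-constant (suc n) i       =
    trans (+ᵖ-cong 1ᵖ 1ᵖ (n ·ᴷ 1ᵖ) ((n · 1ℚ) ∷ []) (λ _ → refl) (·1-constant n) i) (constant-+ i)
    where
    constant-+ : 1ᵖ +ᵖ ((n · 1ℚ) ∷ []) ≈ᵖ (suc n · 1ℚ) ∷ []
    constant-+ i = refl

  n·1-unit : ∀ n .{{_ : NonZero n}} → n ·ᴷ 1ᵖ ∣ᴷ 1ᵖ
  n·1-unit n = (ℚ.1/ c ∷ []) ,ᴷ ≈⇒~ {(ℚ.1/ c ∷ []) *ᵖ (n ·ᴷ 1ᵖ)} {1ᵖ} (λ i →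
    trans (*ᵖ-congˡ (ℚ.1/ c ∷ []) (n ·ᴷ 1ᵖ) (c ∷ []) (·1-constant n) i)
          (trans (constant-* (ℚ.1/ c) (c ∷ []) i) (inverse i)))
    where
    c = n · 1ℚ
    instance
      c-nonZero : ℚ.NonZero c
      c-nonZero = ·1-nonZero n
    inverse : ∀ i → ℚ.1/ c ℚ.* coeff (c ∷ []) i ≡ coeff 1ᵖ i
    inverse zero    = ℚ.*-inverseˡ c
    inverse (suc i) = ℚ.*-zeroʳ (ℚ.1/ c)

  -- The bound of `∑[0…_]` is inclusive and that of `∑<` exclusive, hence `suc n`; the base case
  -- removes the `0#` with which `∑<` starts.
  evaluates-∑ : ∀ (A : ℕ → RatFun) (x : ℕ → Poly) n → (∀ k → k ≤ n → Evaluates (num (A k)) (den (A k)) (x k)) →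
                Evaluates (num (∑[0… n ] A)) (den (∑[0… n ] A)) (∑< (suc n) x)
  evaluates-∑ A x zero    e = evaluates-resp (K.sym {∑< 1 x} {x 0} (K.+-identityˡ (x 0))) (e 0 z≤n)
  evaluates-∑ A x (suc n) e = evaluates-+ (evaluates-∑ A x n λ k k≤n → e k (ℕ.m≤n⇒m≤1+n k≤n)) (e (suc n) ℕ.≤-refl)

  reduce : RatFun → RatFun
  reduce A = n′ / d′ ⟨ d′≉0 (den≉0 A) ⟩
    where open Reduction (lowest-terms A)

  reduce-isLowestTerms : ∀ A → reduce A IsLowestTermsOf A
  reduce-isLowestTerms A = record { equal = cross ; coprime = coprime }
    where open Reduction (lowest-terms A)

  -- A common residue class `x` provides everything in the congruence: unit denominators give the
  -- coprimality conditions, and equal values make the numerator of `A ⊖ B` vanish modulo `M`.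
  ≋-intro : ∀ {A B x} → Evaluates (num A) (den A) x → Evaluates (num B) (den B) x → A ≋ B [mod M ]
  ≋-intro {A} {B} eA eB = record
    { denˡ-coprime  = record { reduced = reduce A ; isLowestTerms = reduce-isLowestTerms A
                             ; den-coprime = reduced-den-coprime (lowest-terms A) (Evaluates.den-unit eA) }
    ; denʳ-coprime  = record { reduced = reduce B ; isLowestTerms = reduce-isLowestTerms B
                             ; den-coprime = reduced-den-coprime (lowest-terms B) (Evaluates.den-unit eB) }
    ; difference    = reduce (A ⊖ B)
    ; isLowestTerms = reduce-isLowestTerms (A ⊖ B)
    ; num-divisible = reduced-num-divisible (lowest-terms (A ⊖ B))
                        (QSeries.unit-* quotientRing (Evaluates.den-unit eA) (Evaluates.den-unit eB))
                        (difference∼0 eA eB)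
    }

module ModuloPrime {p} (p-prime : Prime p) where
  open Modulo [ p ]q
  private
    module K = CommutativeRing quotientRing
    instance
      p-nonZero : NonZero p
      p-nonZero = prime⇒nonZero p-prime

  qᵖ~1 : q ^ᴷ p ~ 1ᵖ
  qᵖ~1 = PowerSums.geometric-root quotientRing q [_]q (K.refl {0ᵖ}) (λ n → ≈⇒~ {[ suc n ]q} {1ᵖ +ᵖ q *ᵖ [ n ]q} ([suc]q n)) p M~0

  1-q∣1 : (1ᵖ -ᵖ q) ∣ᴷ 1ᵖ
  1-q∣1 = PowerSums.1-q-unit quotientRing q [_]q (K.refl {0ᵖ}) (λ n → ≈⇒~ {[ suc n ]q} {1ᵖ +ᵖ q *ᵖ [ n ]q} ([suc]q n)) p M~0 (n·1-unit p)

  open RootOfUnityPowers quotientRing using (-1ᵃ≈-1ᵇ)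
  open RootOfUnityPowers.PrimeOrder quotientRing p-prime q qᵖ~1 1-q∣1 public

  ^ᵖ~^ᴷ : ∀ f n → f ^ᵖ n ~ f ^ᴷ n
  ^ᵖ~^ᴷ f n = K.reflexive (^ᵖ≡^ᴷ f n)

  -- The class of `q^ e` depends only on `e` modulo `p`, so one class accounts for both exponents in
  -- the theorem.
  evaluates-q^ : ∀ e n → + p ℤ.∣ e ℤ.+ + n → Evaluates (num (q^ e)) (den (q^ e)) (q⁻ n)
  evaluates-q^ (+ i)    n p∣e+n = evaluates-resp
    (K.trans {q ^ᵖ i} {q ^ᴷ i} {q⁻ n} (^ᵖ~^ᴷ q i) (q⁻-congruent i n p∣e+n)) (evaluates-element (q ^ᵖ i))
  evaluates-q^ -[1+ i ] n p∣e+n = subst (λ f → Evaluates 1ᵖ f (q⁻ n)) (sym (^ᵖ≡^ᴷ q (suc i)))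
    (evaluates (qⁿ-unit (suc i)) (q⁻-cancel (suc i) n p∣e+n))

  module _ {m r a b} .{{_ : NonZero m}} (p∤m : p ∤ m) (r≤m : r ≤ m) (1+a+b≡p : suc (a + b) ≡ p)
           (p∣ma+r : + p ℤ.∣ + m ℤ.* + a ℤ.+ + r) where

    open Base {m} {q ^ᵖ m} p∤m (^ᵖ~^ᴷ q m) using (ratio; ratio-isRatio; pochhammer-unit; ratio-convolution)

    evaluates-ratio : ∀ α k → k < p → Evaluates (⦅ α ⨾ q ^ᵖ m ⦆ k) (⦅ q ^ᵖ m ⨾ q ^ᵖ m ⦆ k) (ratio α k)
    evaluates-ratio α k k<p = ≡.subst₂ (λ f g → Evaluates f g (ratio α k))
      (sym (⦅⦆≡pochhammer α (q ^ᵖ m) k)) (sym (⦅⦆≡pochhammer (q ^ᵖ m) (q ^ᵖ m) k))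
      (evaluates (pochhammer-unit k k<p) (ratio-isRatio α k k<p))

    evaluates-sum : ∀ s → s ≤ b →
      Evaluates (num (∑[0… p ∸ s ∸ 1 ] (summand m r s))) (den (∑[0… p ∸ s ∸ 1 ] (summand m r s)))
                ((-ᵖ 1ᵖ) ^ᴷ b *ᵖ q⁻ (m * triangular b))
    evaluates-sum s s≤b = evaluates-resp
      (q⁻-unique {∑< (suc N) u*v} {(-ᵖ 1ᵖ) ^ᴷ b} (m * triangular b)
        (ratio-convolution {r} {a} {b} {q ^ᵖ r} {q ^ᵖ (m ∸ r)} r≤m 1+a+b≡p p∣ma+r
          (^ᵖ~^ᴷ q r) (^ᵖ~^ᴷ q (m ∸ r)) s (suc N) s≤b 1+N+s≡p))
      (evaluates-∑ (summand m r s) u*v N λ k k≤N →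
        let k+s<p = subst (k + s <_) 1+N+s≡p (s≤s (ℕ.+-monoˡ-≤ s k≤N)) in
        evaluates-* (evaluates-ratio (q ^ᵖ r) k (ℕ.≤-<-trans (ℕ.m≤m+n k s) k+s<p))
                    (evaluates-ratio (q ^ᵖ (m ∸ r)) (k + s) k+s<p))
      where
      -- The upper limit is inclusive: there are `suc N = p - s` terms, and the largest index
      -- `N + s` is `p - 1`, so every denominator that occurs is a unit.
      N = p ∸ s ∸ 1
      u*v : ℕ → Poly
      u*v k = ratio (q ^ᵖ r) k *ᵖ ratio (q ^ᵖ (m ∸ r)) (k + s)
      s<p : s < p
      s<p = ℕ.≤-<-trans s≤b (subst (b <_) 1+a+b≡p (s≤s (ℕ.m≤n+m b a)))
      1+N+s≡p : suc N + s ≡ p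
      1+N+s≡p = trans (cong (_+ s) (ℕ.m+[n∸m]≡n (ℕ.m<n⇒0<n∸m s<p))) (ℕ.m∸n+n≡m (ℕ.<⇒≤ s<p))

    -- Both congruences of the theorem are instances, for two integers `e` congruent to
    -- `- m * triangular b` modulo `p`. Oddness of `p` lets the sign be written with `a` instead of
    -- `b`.
    sum-≋ : 2 ∤ p → ∀ s → s ≤ b → ∀ e → + p ℤ.∣ e ℤ.+ + (m * triangular b) →
            ∑[0… p ∸ s ∸ 1 ] (summand m r s) ≋ [-1]^ a ⊗ q^ e [mod [ p ]q ]
    sum-≋ 2∤p s s≤b e p∣e+n = ≋-intro (evaluates-sum s s≤b)
      (evaluates-* (evaluates-resp {x = (-ᵖ 1ᵖ) ^ᵖ a} {(-ᵖ 1ᵖ) ^ᴷ b} sign (evaluates-element ((-ᵖ 1ᵖ) ^ᵖ a)))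
                   (evaluates-q^ e (m * triangular b) p∣e+n))
      where
      half = odd⇒suc-double 2∤p
      sign : (-ᵖ 1ᵖ) ^ᵖ a ~ (-ᵖ 1ᵖ) ^ᴷ b
      sign = K.trans {(-ᵖ 1ᵖ) ^ᵖ a} {(-ᵖ 1ᵖ) ^ᴷ a} {(-ᵖ 1ᵖ) ^ᴷ b} (^ᵖ~^ᴷ (-ᵖ 1ᵖ) a)
        (-1ᵃ≈-1ᵇ a b (proj₁ half) (ℕ.suc-injective (trans 1+a+b≡p (proj₂ half))))

theorem2p7 : (p m r : ℕ) .{{_ : NonZero m}} .{{_ : NonZero r}} →
    Prime p → 2 ∤ p → p ∤ m → r < m →
    let a = ⟨ ℚ.- ((+ r) ℚ./ m) ⟩[ p ] in
    (s : ℕ) → s ≤ ⟨ ℚ.- ((+ m ℤ.- + r) ℚ./ m) ⟩[ p ] →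
    (∑[0… p ∸ s ∸ 1 ] (summand m r s)
    ≋ [-1]^ a ⊗ q^ (ℤ.- (+ (m * (a * (a + 1)) / 2))) [mod [ p ]q ])
    ×
    (m ∣ p ∸ 1 ⊎ m ∣ p + 1 →
    ∃[ e ] ((+ 2 ℤ.* + m) ℤ.* e ≡ (+ r ℤ.* (+ m ℤ.- + r)) ℤ.* (1ℤ ℤ.- + p ℤ.* + p)
    × (∑[0… p ∸ s ∸ 1 ] (summand m r s) ≋ [-1]^ a ⊗ q^ e [mod [ p ]q ])))
theorem2p7 p m@(suc m-1) r p-prime 2∤p p∤m r<m s s≤b =
  congruence (ℤ.- + (m * (a * (a + 1)) / 2)) (exponent-triangular {a = a} m p-prime p∤2 1+a+b≡p) , λ m∣p±1 →
    let e , e-equation = exponent-exists (+ r ℤ.* (+ m ℤ.- + r)) 2∤p m∣p±1 in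
    e , e-equation , congruence e (exponent-quadratic {b = b} (+ r) e p-prime p∤2 p∤m (proj₂ b-residue) e-equation)
  where
  a b : ℕ
  a = ⟨ ℚ.- ((+ r) ℚ./ m) ⟩[ p ]
  b = ⟨ ℚ.- ((+ m ℤ.- + r) ℚ./ m) ⟩[ p ]
  p∤2 : p ∤ 2
  p∤2 = odd-prime-∤2 p-prime 2∤p
  a-residue : a < p × + p ℤ.∣ + m ℤ.* + a ℤ.- ℤ.- + r
  a-residue = residue-of-neg p-prime p∤m (+ r)
  b-residue : b < p × + p ℤ.∣ + m ℤ.* + b ℤ.- ℤ.- (+ m ℤ.- + r)
  b-residue = residue-of-neg p-prime p∤m (+ m ℤ.- + r)
  1+a+b≡p : suc (a + b) ≡ p
  1+a+b≡p = residues-complementary (+ r) p-prime p∤m (proj₁ a-residue) (proj₁ b-residue) (proj₂ a-residue) (proj₂ b-residue)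
  p∣ma+r : + p ℤ.∣ + m ℤ.* + a ℤ.+ + r
  p∣ma+r = subst (λ x → + p ℤ.∣ + m ℤ.* + a ℤ.+ x) (ℤ.neg-involutive (+ r)) (proj₂ a-residue)
  congruence : ∀ e → + p ℤ.∣ e ℤ.+ + (m * triangular b) →
               ∑[0… p ∸ s ∸ 1 ] (summand m r s) ≋ [-1]^ a ⊗ q^ e [mod [ p ]q ]
  congruence = ModuloPrime.sum-≋ p-prime p∤m (ℕ.<⇒≤ r<m) 1+a+b≡p p∣ma+r 2∤p s s≤b
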